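{- Let $k\geqslant 5$. There exists a non-decreasing function $f:\mathbb{N}\to\mathbb{N}$ with $n\leqslant f(n)\leqslant R(K_n^{(k)})$ for all $n$, such that for all $c,C>0$ and any $n_0$, there is an $n>n_0$ such that $$R(H)\leqslant c f(n)\quad\text{or}\quad R(H)\geqslant C f(n)$$ for every $k$-graph $H$ on $n$ vertices.
   Context: A $k$-graph is a pair $H=(V,E)$ where every edge $e\in E$ is a $k$-element subset of the vertex set $V$. $K_n^{(k)}$ is the $k$-graph on $n$ vertices in which every $k$-element subset of vertices is an edge. For a $k$-graph $H$, the Ramsey number $R(H)$ is the smallest integer $N$ such that every red-blue colouring of the edges of $K_N^{(k)}$ contains a copy of $H$ all of whose edges have the same colour. -}

module Defs where

open import Data.Fin.Base using (Fin; zero; suc; finToFun; funToFin)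
open import Data.Fin.Properties using (any?; all?; finToFun-funToFin)
  renaming (_≟_ to _≟ᶠ_)
open import Data.Fin.Subset using (Subset; ∣_∣; _∈_; inside; outside; ⊥)
open import Data.Fin.Subset.Properties
  using (_∈?_; anySubset?; ⊆-antisym; ∉⊥; ∣⊥∣≡0)
open import Data.Integer.Base using (+_)
open import Data.List.Base
  using (List; []; _∷_; length; take; map; allFin; tabulate; lookup)
open import Data.List.Membership.Propositional using () renaming (_∈_ to _∈ˡ_)
open import Data.List.Membership.Propositional.Properties
  using (∈-map⁺; ∈-map⁻; ∈-lookup)
open import Data.List.Properties
  using (length-map; length-take; length-tabulate; map-tabulate; tabulate-lookup)
open import Data.List.Relation.Binary.Sublist.Propositional
  using (_⊆_; []; _∷ʳ_; _∷_; ⊆-refl; ⊆-trans; minimum)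
open import Data.List.Relation.Binary.Sublist.Propositional.Properties
  using (All-resp-⊆; take-⊆) renaming (map⁺ to ⊆-map⁺)
open import Data.List.Relation.Unary.All as All using ()
open import Data.List.Relation.Unary.AllPairs using ([]; _∷_)
open import Data.List.Relation.Unary.Any using (here; there)
open import Data.List.Relation.Unary.Unique.Propositional using (Unique)
open import Data.List.Relation.Unary.Unique.Propositional.Properties using (allFin⁺)
open import Data.Nat.Base using (ℕ; zero; suc; _≤_; z≤n; s≤s; _⊔_)
import Data.Nat.Properties as ℕ
open import Data.Product.Base using (Σ; ∃; _×_; _,_; proj₁; proj₂)
open import Data.Rational.Base as ℚ using (ℚ; 0ℚ; 1ℚ)
import Data.Rational.Properties as ℚ
open import Data.Sum.Base using (_⊎_; inj₁; inj₂)
open import Data.Vec.Base as Vec using ([]; _∷_; _[_]≔_)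
import Data.Vec.Properties as Vec
open import Function.Base using (_∘_; id)
open import Function.Definitions using (Injective)
open import Relation.Binary.PropositionalEquality
  using (_≡_; _≗_; refl; sym; trans; cong; subst)
open import Relation.Nullary using (Dec; yes; no; does; ¬_; contradiction)
open import Relation.Nullary.Decidable
  using (map′; _×-dec_; _→-dec_; ¬?; decidable-stable; dec-true)
open import Relation.Unary using (Decidable)

private
  variable
    k m n N : ℕ

-- A k-graph on n vertices, the vertex set being Fin n. Decidability of the
-- edge predicate says that the edges form a subset of the (finite) powerset
-- of the vertex set in the classical sense.
record KGraph (k n : ℕ) : Set₁ where
  field
    Edge    : Subset n → Set
    edge?   : Decidable Edge
    uniform : ∀ {e} → Edge e → ∣ e ∣ ≡ k

open KGraph public

K : (k n : ℕ) → KGraph k n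
K k n = record
  { Edge    = λ e → ∣ e ∣ ≡ k
  ; edge?   = λ e → ∣ e ∣ ℕ.≟ k
  ; uniform = id
  }

data Colour : Set where
  red blue : Colour

_≟ᶜ_ : (c d : Colour) → Dec (c ≡ d)
red  ≟ᶜ red  = yes refl
red  ≟ᶜ blue = no λ ()
blue ≟ᶜ red  = no λ ()
blue ≟ᶜ blue = yes refl

Colouring : (k N : ℕ) → Set
Colouring k N = (e : Subset N) → Edge (K k N) e → Colour

_restrictedTo_ : Colouring k N → Colour → KGraph k N
_restrictedTo_ {k} {N} χ c = record
  { Edge    = λ e → Σ (Edge (K k N) e) λ p → χ e p ≡ c
  ; edge?   = dec
  ; uniform = proj₁
  }
  where
  dec : ∀ e → Dec (Σ (∣ e ∣ ≡ k) λ p → χ e p ≡ c)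
  dec e with ∣ e ∣ ℕ.≟ k
  ... | no ¬p = no (¬p ∘ proj₁)
  ... | yes p = map′ (p ,_)
    (λ (q , eq) → trans (cong (χ e) (ℕ.≡-irrelevant p q)) eq) (χ e p ≟ᶜ c)

image : (Fin n → Fin N) → Subset n → Subset N
image φ e = Vec.tabulate λ j → does (any? λ i → (i ∈? e) ×-dec (φ i ≟ᶠ j))

infix 4 _↪_ _⟶_

-- Copies are not necessarily induced.
_↪_ : KGraph k n → KGraph k N → Set
_↪_ {n = n} {N = N} H G = ∃ λ (φ : Fin n → Fin N) →
  Injective _≡_ _≡_ φ × (∀ e → Edge H e → Edge G (image φ e))

_⟶_ : ℕ → KGraph k n → Set
_⟶_ {k = k} N H = (χ : Colouring k N) → ∃ λ c → H ↪ χ restrictedTo c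

-- What follows, up to R, proves that for every H there is an N with N ⟶ H and
-- that N ⟶ H is decidable, so that there is a least such N.

-- Ramsey's theorem is first proved for lists, a k-subset of a list being a
-- sublist of length k.

Homogeneous : {A : Set} → ℕ → (List A → Colour) → Colour → List A → Set
Homogeneous k χ c ys = ∀ zs → zs ⊆ ys → length zs ≡ k → χ zs ≡ c

HomogeneousSublist : {A : Set} → ℕ → (List A → Colour) → Colour → ℕ → List A → Set
HomogeneousSublist k χ c m xs =
  ∃ λ ys → ys ⊆ xs × m ≤ length ys × Homogeneous k χ c ys

ListRamsey : (k a b : ℕ) → Set₁
ListRamsey k a b = ∃ λ N → ∀ {A : Set} (χ : List A → Colour) xs → N ≤ length xs →
  HomogeneousSublist k χ red a xs ⊎ HomogeneousSublist k χ blue b xs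

private
  weaken : ∀ {A : Set} {χ : List A → Colour} {c xs ys} → xs ⊆ ys →
           HomogeneousSublist k χ c m xs → HomogeneousSublist k χ c m ys
  weaken τ (zs , σ , l , h) = zs , ⊆-trans σ τ , l , h

  extend : ∀ {A : Set} {χ : List A → Colour} {c xs ys x} → ys ⊆ xs →
           Homogeneous k (χ ∘ (x ∷_)) c ys → HomogeneousSublist (suc k) χ c m ys →
           HomogeneousSublist (suc k) χ c (suc m) (x ∷ xs)
  extend {k = k} {χ = χ} {c = c} {x = x} τ h (zs , σ , l , g) =
    x ∷ zs , refl ∷ ⊆-trans σ τ , s≤s l , hom
    where
    hom : Homogeneous (suc k) χ c (x ∷ zs)
    hom ws       (_ ∷ʳ ρ)   eq = g ws ρ eq
    hom (_ ∷ ws) (refl ∷ ρ) eq = h ws (⊆-trans ρ σ) (ℕ.suc-injective eq)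

  trivial : ∀ {A : Set} {χ : List A → Colour} {c xs} →
            HomogeneousSublist (suc k) χ c 0 xs
  trivial = [] , minimum _ , z≤n , λ { [] _ () ; (_ ∷ _) () _ }

  ramsey-step : (∀ m → ListRamsey k m m) → ∀ a b → ListRamsey (suc k) a b
  ramsey-step ih zero    b       = 0 , λ _ _ _ → inj₁ trivial
  ramsey-step ih (suc a) zero    = 0 , λ _ _ _ → inj₂ trivial
  ramsey-step {k = k} ih (suc a) (suc b)
    with ramsey-step ih a (suc b) | ramsey-step ih (suc a) b
  ... | N₁ , r₁ | N₂ , r₂ with ih (N₁ ⊔ N₂)
  ... | N₃ , r₃ = suc N₃ , go
    where
    go : ∀ {A : Set} (χ : List A → Colour) xs → suc N₃ ≤ length xs →
         HomogeneousSublist (suc k) χ red (suc a) xs ⊎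
         HomogeneousSublist (suc k) χ blue (suc b) xs
    go χ (x ∷ xs) (s≤s p) with r₃ (χ ∘ (x ∷_)) xs p
    ... | inj₁ (ys , τ , l , h)
        with r₁ χ ys (ℕ.≤-trans (ℕ.m≤m⊔n N₁ N₂) l)
    ...   | inj₁ s = inj₁ (extend τ h s)
    ...   | inj₂ s = inj₂ (weaken (x ∷ʳ τ) s)
    go χ (x ∷ xs) (s≤s p) | inj₂ (ys , τ , l , h)
        with r₂ χ ys (ℕ.≤-trans (ℕ.m≤n⊔m N₁ N₂) l)
    ...   | inj₁ s = inj₁ (weaken (x ∷ʳ τ) s)
    ...   | inj₂ s = inj₂ (extend τ h s)

listRamsey : ∀ k m → ListRamsey k m m
listRamsey zero m = m , go
  where
  go : ∀ {A : Set} (χ : List A → Colour) xs → m ≤ length xs →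
       HomogeneousSublist 0 χ red m xs ⊎ HomogeneousSublist 0 χ blue m xs
  go χ xs p with χ [] in eq
  ... | red  = inj₁ (xs , ⊆-refl , p , λ { [] _ _ → eq ; (_ ∷ _) _ () })
  ... | blue = inj₂ (xs , ⊆-refl , p , λ { [] _ _ → eq ; (_ ∷ _) _ () })
listRamsey (suc k) m = ramsey-step (listRamsey k) m m

fromList : List (Fin n) → Subset n
fromList []       = ⊥
fromList (x ∷ xs) = fromList xs [ x ]≔ inside

elements : Subset n → List (Fin n)
elements []            = []
elements (inside  ∷ e) = zero ∷ map suc (elements e)
elements (outside ∷ e) = map suc (elements e)

private
  ∈-insert⁺ : ∀ {x y} (e : Subset n) → x ∈ e → x ∈ (e [ y ]≔ inside)
  ∈-insert⁺ {x = x} {y} e p with x ≟ᶠ y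
  ... | yes refl = Vec.[]≔-updates e x
  ... | no  x≢y  = Vec.[]≔-minimal e x y x≢y p

  ∈-insert⁻ : ∀ {x} (e : Subset n) y → x ∈ (e [ y ]≔ inside) → x ≡ y ⊎ x ∈ e
  ∈-insert⁻ {x = zero} (_ ∷ e) zero    p             = inj₁ refl
  ∈-insert⁻            (_ ∷ e) zero    (Vec.there p) = inj₂ (Vec.there p)
  ∈-insert⁻            (_ ∷ e) (suc y) Vec.here      = inj₂ Vec.here
  ∈-insert⁻            (_ ∷ e) (suc y) (Vec.there p) with ∈-insert⁻ e y p
  ... | inj₁ refl = inj₁ refl
  ... | inj₂ q    = inj₂ (Vec.there q)

  ∣insert∣ : ∀ (e : Subset n) x → ¬ x ∈ e → ∣ e [ x ]≔ inside ∣ ≡ suc ∣ e ∣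
  ∣insert∣ (inside  ∷ e) zero    x∉e = contradiction Vec.here x∉e
  ∣insert∣ (outside ∷ e) zero    x∉e = refl
  ∣insert∣ (inside  ∷ e) (suc x) x∉e = cong suc (∣insert∣ e x (x∉e ∘ Vec.there))
  ∣insert∣ (outside ∷ e) (suc x) x∉e = ∣insert∣ e x (x∉e ∘ Vec.there)

  ∈-fromList⁺ : ∀ {x : Fin n} xs → x ∈ˡ xs → x ∈ fromList xs
  ∈-fromList⁺ (x ∷ xs) (here refl) = Vec.[]≔-updates (fromList xs) x
  ∈-fromList⁺ (x ∷ xs) (there p)   = ∈-insert⁺ (fromList xs) (∈-fromList⁺ xs p)

  ∈-fromList⁻ : ∀ {x : Fin n} xs → x ∈ fromList xs → x ∈ˡ xs
  ∈-fromList⁻ []       p = contradiction p ∉⊥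
  ∈-fromList⁻ (y ∷ xs) p with ∈-insert⁻ (fromList xs) y p
  ... | inj₁ refl = here refl
  ... | inj₂ q    = there (∈-fromList⁻ xs q)

  ∣fromList∣ : ∀ (xs : List (Fin n)) → Unique xs → ∣ fromList xs ∣ ≡ length xs
  ∣fromList∣ {n} []    _        = ∣⊥∣≡0 n
  ∣fromList∣ (x ∷ xs) (px ∷ u) = trans
    (∣insert∣ (fromList xs) x λ p → All.lookup px (∈-fromList⁻ xs p) refl)
    (cong suc (∣fromList∣ xs u))

  ∈-elements⁺ : ∀ {x} (e : Subset n) → x ∈ e → x ∈ˡ elements e
  ∈-elements⁺ (inside  ∷ e) Vec.here      = here refl
  ∈-elements⁺ (inside  ∷ e) (Vec.there p) = there (∈-map⁺ suc (∈-elements⁺ e p))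
  ∈-elements⁺ (outside ∷ e) (Vec.there p) = ∈-map⁺ suc (∈-elements⁺ e p)

  ∈-elements⁻ : ∀ {x} (e : Subset n) → x ∈ˡ elements e → x ∈ e
  ∈-elements⁻ (inside  ∷ e) (here refl) = Vec.here
  ∈-elements⁻ (inside  ∷ e) (there p) with ∈-map⁻ suc p
  ... | y , q , refl = Vec.there (∈-elements⁻ e q)
  ∈-elements⁻ (outside ∷ e) p with ∈-map⁻ suc p
  ... | y , q , refl = Vec.there (∈-elements⁻ e q)

  length-elements : ∀ (e : Subset n) → length (elements e) ≡ ∣ e ∣
  length-elements []            = refl
  length-elements (inside  ∷ e) =
    cong suc (trans (length-map suc (elements e)) (length-elements e))
  length-elements (outside ∷ e) =
    trans (length-map suc (elements e)) (length-elements e)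

  elements-⊆ : ∀ (e : Subset n) → elements e ⊆ allFin n
  elements-⊆ []              = []
  elements-⊆ {suc n} (s ∷ e) = go s
    where
    τ : map suc (elements e) ⊆ tabulate suc
    τ = subst (map suc (elements e) ⊆_) (map-tabulate id suc)
          (⊆-map⁺ suc (elements-⊆ e))
    go : ∀ s → elements (s ∷ e) ⊆ allFin (suc n)
    go inside  = refl ∷ τ
    go outside = zero ∷ʳ τ

  unique-⊆ : ∀ {A : Set} {xs ys : List A} → xs ⊆ ys → Unique ys → Unique xs
  unique-⊆ []         u        = u
  unique-⊆ (y ∷ʳ τ)   (_ ∷ u)  = unique-⊆ τ u
  unique-⊆ (refl ∷ τ) (px ∷ u) = All-resp-⊆ τ px ∷ unique-⊆ τ u

  lookup-injective : ∀ {A : Set} {xs : List A} → Unique xs →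
                     Injective _≡_ _≡_ (lookup xs)
  lookup-injective {xs = x ∷ xs} (px ∷ u) {zero}  {zero}  eq = refl
  lookup-injective {xs = x ∷ xs} (px ∷ u) {zero}  {suc j} eq =
    contradiction eq (All.lookup px (∈-lookup j))
  lookup-injective {xs = x ∷ xs} (px ∷ u) {suc i} {zero}  eq =
    contradiction (sym eq) (All.lookup px (∈-lookup i))
  lookup-injective {xs = x ∷ xs} (px ∷ u) {suc i} {suc j} eq =
    cong suc (lookup-injective u eq)

∈-image⁺ : ∀ (φ : Fin n → Fin N) {e i} → i ∈ e → φ i ∈ image φ e
∈-image⁺ φ {e} {i} p = Vec.lookup⇒[]= (φ i) (image φ e) (trans
  (Vec.lookup∘tabulate _ (φ i))
  (dec-true (any? λ i′ → (i′ ∈? e) ×-dec (φ i′ ≟ᶠ φ i)) (i , p , refl)))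

∈-image⁻ : ∀ (φ : Fin n → Fin N) {e j} → j ∈ image φ e → ∃ λ i → i ∈ e × φ i ≡ j
∈-image⁻ φ {e} {j} p
  with any? (λ i → (i ∈? e) ×-dec (φ i ≟ᶠ j))
     | trans (sym (Vec.lookup∘tabulate
         (λ j → does (any? λ i → (i ∈? e) ×-dec (φ i ≟ᶠ j))) j))
         (Vec.[]=⇒lookup p)
... | yes q | _ = q
... | no  _ | ()

image≡fromList : ∀ (φ : Fin n → Fin N) e → image φ e ≡ fromList (map φ (elements e))
image≡fromList φ e = ⊆-antisym to from
  where
  to : ∀ {j} → j ∈ image φ e → j ∈ fromList (map φ (elements e))
  to p with ∈-image⁻ φ p
  ... | i , q , refl = ∈-fromList⁺ _ (∈-map⁺ φ (∈-elements⁺ e q))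
  from : ∀ {j} → j ∈ fromList (map φ (elements e)) → j ∈ image φ e
  from p with ∈-map⁻ φ (∈-fromList⁻ (map φ (elements e)) p)
  ... | i , q , refl = ∈-image⁺ φ (∈-elements⁻ e q)

image-cong : ∀ {φ ψ : Fin n → Fin N} → φ ≗ ψ → ∀ e → image φ e ≡ image ψ e
image-cong {φ = φ} {ψ} φ≗ψ e = ⊆-antisym (half φ≗ψ) (half (sym ∘ φ≗ψ))
  where
  half : ∀ {φ ψ} → φ ≗ ψ → ∀ {j} → j ∈ image φ e → j ∈ image ψ e
  half {φ} {ψ} φ≗ψ p with ∈-image⁻ φ p
  ... | i , q , refl = subst (_∈ image ψ e) (sym (φ≗ψ i)) (∈-image⁺ ψ q)

private
  -- The value red on sets that are not k-subsets is arbitrary.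
  total : Colouring k N → Subset N → Colour
  total {k} χ e with ∣ e ∣ ℕ.≟ k
  ... | yes p = χ e p
  ... | no  _ = red

  total-≡ : ∀ (χ : Colouring k N) e p → total χ e ≡ χ e p
  total-≡ {k} χ e p with ∣ e ∣ ℕ.≟ k
  ... | yes q = cong (χ e) (ℕ.≡-irrelevant q p)
  ... | no ¬p = contradiction p ¬p

  partial : (Subset N → Colour) → Colouring k N
  partial χ e _ = χ e

  toCopy : ∀ (χ : Colouring k N) c ys → ys ⊆ allFin N →
           Homogeneous k (total χ ∘ fromList) c ys →
           (H : KGraph k (length ys)) → H ↪ χ restrictedTo c
  toCopy {k} {N} χ c ys τ hom H =
    lookup ys , lookup-injective (unique-⊆ τ (allFin⁺ N)) , edges
    where
    edges : ∀ e → Edge H e → Edge (χ restrictedTo c) (image (lookup ys) e)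
    edges e he = subst (Edge (χ restrictedTo c)) (sym (image≡fromList (lookup ys) e))
        (card , trans (sym (total-≡ χ _ card)) (hom zs σ len))
      where
      zs = map (lookup ys) (elements e)
      σ : zs ⊆ ys
      σ = subst (zs ⊆_) (trans (map-tabulate id (lookup ys)) (tabulate-lookup ys))
            (⊆-map⁺ (lookup ys) (elements-⊆ e))
      len : length zs ≡ k
      len = trans (length-map (lookup ys) (elements e))
              (trans (length-elements e) (uniform H he))
      card : ∣ fromList zs ∣ ≡ k
      card = trans
        (∣fromList∣ zs (unique-⊆ (⊆-trans σ τ) (allFin⁺ N))) len

ramsey-exists : (H : KGraph k n) → ∃ λ N → N ⟶ H
ramsey-exists {k} {n} H with listRamsey k n
... | N , r = N , arrow
  where
  fromHom : ∀ χ c → HomogeneousSublist k (total χ ∘ fromList) c n (allFin N) →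
            H ↪ χ restrictedTo c
  fromHom χ c (ys , τ , l , hom) = go (trans (length-take n ys) (ℕ.m≤n⇒m⊓n≡m l)) H
    where
    go : ∀ {m} → length (take n ys) ≡ m → (H : KGraph k m) → H ↪ χ restrictedTo c
    go refl = toCopy χ c (take n ys) (⊆-trans (take-⊆ n ys) τ)
      λ zs σ → hom zs (⊆-trans σ (take-⊆ n ys))
  arrow : N ⟶ H
  arrow χ with r (total χ ∘ fromList) (allFin N)
                 (ℕ.≤-reflexive (sym (length-tabulate {n = N} id)))
  ... | inj₁ s = red  , fromHom χ red s
  ... | inj₂ s = blue , fromHom χ blue s

private
  allSubset? : ∀ {P : Subset n → Set} → Decidable P → Dec (∀ e → P e)
  allSubset? P? = map′
    (λ ¬∃ e → decidable-stable (P? e) λ ¬p → ¬∃ (e , ¬p))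
    (λ ∀P (e , ¬p) → ¬p (∀P e))
    (¬? (anySubset? (¬? ∘ P?)))

  anyFun? : ∀ {P : (Fin n → Fin N) → Set} → (∀ {φ ψ} → φ ≗ ψ → P φ → P ψ) →
            Decidable P → Dec (∃ P)
  anyFun? {n} {N} {P} resp P? = map′
    (λ (i , p) → finToFun {N} {n} i , p)
    (λ (φ , p) → funToFin φ , resp (sym ∘ finToFun-funToFin φ) p)
    (any? (P? ∘ finToFun))

  allColouring? : ∀ N {P : (Subset N → Colour) → Set} →
                  (∀ {χ ξ} → χ ≗ ξ → P χ → P ξ) → Decidable P → Dec (∀ χ → P χ)
  allColouring? zero {P} resp P? = map′ to from (P? (λ _ → red) ×-dec P? (λ _ → blue))
    where
    to : P (λ _ → red) × P (λ _ → blue) → ∀ χ → P χ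
    to (p , q) χ with χ [] in eq
    ... | red  = resp (λ { [] → sym eq }) p
    ... | blue = resp (λ { [] → sym eq }) q
    from : (∀ χ → P χ) → P (λ _ → red) × P (λ _ → blue)
    from p = p _ , p _
  allColouring? (suc N) {P} resp P? = map′
    (λ p χ → resp (λ { (inside ∷ e) → refl ; (outside ∷ e) → refl })
               (p (χ ∘ (inside ∷_)) (χ ∘ (outside ∷_))))
    (λ p χ ξ → p (join χ ξ))
    (allColouring? N
      (λ eq p ξ → resp (λ { (inside ∷ e) → eq e ; (outside ∷ e) → refl }) (p ξ))
      λ χ → allColouring? N
        (λ eq → resp (λ { (inside ∷ e) → refl ; (outside ∷ e) → eq e }))
        λ ξ → P? (join χ ξ))
    where
    join : (χ ξ : Subset N → Colour) → Subset (suc N) → Colour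
    join χ ξ (inside  ∷ e) = χ e
    join χ ξ (outside ∷ e) = ξ e

  anyColour? : ∀ {P : Colour → Set} → Decidable P → Dec (∃ P)
  anyColour? P? with P? red | P? blue
  ... | yes p | _     = yes (red , p)
  ... | no _  | yes q = yes (blue , q)
  ... | no ¬p | no ¬q = no λ { (red , p) → ¬p p ; (blue , q) → ¬q q }

_↪?_ : (H : KGraph k n) (G : KGraph k N) → Dec (H ↪ G)
_↪?_ {n = n} H G = anyFun?
  (λ {φ} {ψ} φ≗ψ (inj , h) →
      (λ {i} {j} eq → inj (trans (φ≗ψ i) (trans eq (sym (φ≗ψ j)))))
    , (λ e he → subst (Edge G) (image-cong φ≗ψ e) (h e he)))
  λ φ → map′ (λ inj {i} {j} → inj i j) (λ inj i j → inj)
          (all? λ i → all? λ j → (φ i ≟ᶠ φ j) →-dec (i ≟ᶠ j))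
        ×-dec allSubset? λ e → edge? H e →-dec edge? G (image φ e)

_⟶?_ : ∀ N (H : KGraph k n) → Dec (N ⟶ H)
_⟶?_ {k} N H = map′
  (λ p χ → mono (λ e q → total-≡ χ e q) (p (total χ)))
  (λ p χ → p (partial χ))
  (allColouring? N
    (λ eq → mono (λ e _ → eq e))
    λ χ → anyColour? λ c → H ↪? (partial χ restrictedTo c))
  where
  mono : ∀ {χ ξ : Colouring k N} → (∀ e p → χ e p ≡ ξ e p) →
         (∃ λ c → H ↪ χ restrictedTo c) → ∃ λ c → H ↪ ξ restrictedTo c
  mono eq (c , φ , inj , h) = c , φ , inj , λ e he →
    proj₁ (h e he) , trans (sym (eq _ (proj₁ (h e he)))) (proj₂ (h e he))

private
  least : ∀ {P : ℕ → Set} → Decidable P → ∀ N → P N →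
          ∃ λ m → P m × (∀ M → P M → m ≤ M)
  least P? zero p = 0 , p , λ _ _ → z≤n
  least P? (suc N) p with P? 0
  ... | yes p₀ = 0 , p₀ , λ _ _ → z≤n
  ... | no ¬p₀ with least (P? ∘ suc) N p
  ...   | m , q , min = suc m , q ,
          λ { zero p₀ → contradiction p₀ ¬p₀ ; (suc M) r → s≤s (min M r) }

-- Abstract so that the search for the least N never unfolds; the type
-- determines N.
abstract
  ramseyNumber : (H : KGraph k n) → ∃ λ N → N ⟶ H × (∀ M → M ⟶ H → N ≤ M)
  ramseyNumber H =
    least (_⟶? H) (proj₁ (ramsey-exists H)) (proj₂ (ramsey-exists H))

R : KGraph k n → ℕ
R H = proj₁ (ramseyNumber H)

-- Real numbers are Cauchy sequences of rationals; equality is never needed,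
-- only the orders below.
record ℝ : Set where
  field
    seq    : ℕ → ℚ
    cauchy : ∀ ε → 0ℚ ℚ.< ε → ∃ λ M → ∀ i j → M ≤ i → M ≤ j →
             ℚ.∣ seq i ℚ.- seq j ∣ ℚ.≤ ε

open ℝ public

infix 4 _≤ᴿ_ _<ᴿ_
infixl 7 _·_

_≤ᴿ_ : ℝ → ℝ → Set
x ≤ᴿ y = ∀ ε → 0ℚ ℚ.< ε → ∃ λ M → ∀ i → M ≤ i → seq x i ℚ.≤ seq y i ℚ.+ ε

_<ᴿ_ : ℝ → ℝ → Set
x <ᴿ y = ∃ λ δ → 0ℚ ℚ.< δ × ∃ λ M → ∀ i → M ≤ i → seq x i ℚ.+ δ ℚ.≤ seq y i

ℕ→ℚ : ℕ → ℚ
ℕ→ℚ n = + n ℚ./ 1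

ℕ→ℝ : ℕ → ℝ
ℕ→ℝ n = record
  { seq    = λ _ → ℕ→ℚ n
  ; cauchy = λ ε 0<ε → 0 , λ _ _ _ _ →
      subst (λ q → ℚ.∣ q ∣ ℚ.≤ ε) (sym (ℚ.+-inverseʳ (ℕ→ℚ n))) (ℚ.<⇒≤ 0<ε)
  }

0ᴿ : ℝ
0ᴿ = ℕ→ℝ 0

_·_ : ℝ → ℕ → ℝ
x · n = record { seq = λ i → seq x i ℚ.* q ; cauchy = cau }
  where
  q = ℕ→ℚ n
  cau : ∀ ε → 0ℚ ℚ.< ε → ∃ λ M → ∀ i j → M ≤ i → M ≤ j →
        ℚ.∣ seq x i ℚ.* q ℚ.- seq x j ℚ.* q ∣ ℚ.≤ ε
  cau ε 0<ε = proj₁ cx , bound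
    where
    instance
      q≥0 : ℚ.NonNegative q
      q≥0 = ℚ.normalize-nonNeg n 1
      ε>0 : ℚ.Positive ε
      ε>0 = ℚ.positive 0<ε
      q+1>0 : ℚ.Positive (q ℚ.+ 1ℚ)
      q+1>0 = ℚ.nonNeg+pos⇒pos q 1ℚ
      q+1≢0 : ℚ.NonZero (q ℚ.+ 1ℚ)
      q+1≢0 = ℚ.pos⇒nonZero (q ℚ.+ 1ℚ)
      inv>0 : ℚ.Positive (ℚ.1/ (q ℚ.+ 1ℚ))
      inv>0 = ℚ.1/pos⇒pos (q ℚ.+ 1ℚ)
    η = ε ℚ.* ℚ.1/ (q ℚ.+ 1ℚ)
    instance
      η>0 : ℚ.Positive η
      η>0 = ℚ.pos*pos⇒pos ε (ℚ.1/ (q ℚ.+ 1ℚ))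
      η≥0 : ℚ.NonNegative η
      η≥0 = ℚ.pos⇒nonNeg η
    cx = cauchy x η (ℚ.positive⁻¹ η)
    open ℚ.≤-Reasoning
    bound : ∀ i j → proj₁ cx ≤ i → proj₁ cx ≤ j →
            ℚ.∣ seq x i ℚ.* q ℚ.- seq x j ℚ.* q ∣ ℚ.≤ ε
    bound i j p r = begin
      ℚ.∣ seq x i ℚ.* q ℚ.- seq x j ℚ.* q ∣
        ≡⟨ cong (λ t → ℚ.∣ seq x i ℚ.* q ℚ.+ t ∣) (ℚ.neg-distribˡ-* (seq x j) q) ⟩
      ℚ.∣ seq x i ℚ.* q ℚ.+ (ℚ.- seq x j) ℚ.* q ∣
        ≡⟨ cong ℚ.∣_∣ (ℚ.*-distribʳ-+ q (seq x i) (ℚ.- seq x j)) ⟨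
      ℚ.∣ (seq x i ℚ.- seq x j) ℚ.* q ∣
        ≡⟨ ℚ.∣p*q∣≡∣p∣*∣q∣ (seq x i ℚ.- seq x j) q ⟩
      ℚ.∣ seq x i ℚ.- seq x j ∣ ℚ.* ℚ.∣ q ∣
        ≡⟨ cong (ℚ.∣ seq x i ℚ.- seq x j ∣ ℚ.*_) (ℚ.0≤p⇒∣p∣≡p (ℚ.nonNegative⁻¹ q)) ⟩
      ℚ.∣ seq x i ℚ.- seq x j ∣ ℚ.* q
        ≤⟨ ℚ.*-monoʳ-≤-nonNeg q (proj₂ cx i j p r) ⟩
      η ℚ.* q
        ≡⟨ cong (η ℚ.*_) (ℚ.+-identityʳ q) ⟨
      η ℚ.* (q ℚ.+ 0ℚ)
        ≤⟨ ℚ.*-monoˡ-≤-nonNeg η (ℚ.+-monoʳ-≤ q (ℚ.nonNegative⁻¹ 1ℚ)) ⟩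
      η ℚ.* (q ℚ.+ 1ℚ)
        ≡⟨ ℚ.*-assoc ε (ℚ.1/ (q ℚ.+ 1ℚ)) (q ℚ.+ 1ℚ) ⟩
      ε ℚ.* (ℚ.1/ (q ℚ.+ 1ℚ) ℚ.* (q ℚ.+ 1ℚ))
        ≡⟨ cong (ε ℚ.*_) (ℚ.*-inverseˡ (q ℚ.+ 1ℚ)) ⟩
      ε ℚ.* 1ℚ
        ≡⟨ ℚ.*-identityʳ ε ⟩
      ε ∎

{-# OPTIONS --safe #-}
module Submission where

-- There are at most 2 ^ (n ^ k) distinct values R(H) for k-graphs H on n
-- vertices, whereas for k ≥ 5 the interval from n to R(K_n) is so long, even
-- on a logarithmic scale, that it contains more disjoint intervals of ratio n²
-- than that. Hence some such interval contains no R(H), and g(n) is its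
-- geometric centre. The function f agrees with g infinitely often: it is kept
-- constant after each such n until it has been overtaken by the identity.
--
-- The bound on R(K_n) needed is triply exponential in n for k = 5. It is
-- obtained from the Erdős–Hajnal stepping-up construction: with δ x y the
-- highest binary digit in which x and y differ, a triple x < y < z is coloured
-- according to whether δ x y < δ y z, and a colouring of the k-subsets of N,
-- k ≥ 3, is transported to the (k + 1)-subsets of 2 ^ N through the
-- consecutive differences δ when these are monotone, and by the kind of their
-- first turn otherwise.

open import Data.Bool.Base using (if_then_else_)
import Data.Bool.Properties as Bool
open import Data.Empty using (⊥)
open import Data.Fin.Base as Fin using (Fin; zero; suc; toℕ; inject₁; finToFun; funToFin)
open import Data.Fin.Properties
  using (any?; pigeonhole; injective⇒≤; inject₁-injective; finToFun-funToFin; toℕ<n;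
         toℕ≤pred[n])
  renaming (_≟_ to _≟ᶠ_)
open import Data.Fin.Subset using (Subset; inside; outside; ∣_∣)
  renaming (_∈_ to _∈ˢ_; ⊤ to full)
open import Data.Fin.Subset.Properties using (⊆-antisym; ∈⊤; ∣⊤∣≡n)
import Data.Integer.Base as ℤ
import Data.Integer.Properties as ℤ
open import Data.List.Base
  using (List; []; _∷_; _++_; length; map; lookup; take; drop; reverse)
open import Data.List.Membership.Propositional using (_∈_)
open import Data.List.Membership.Propositional.Properties using (∈-map⁺; ∈-map⁻; ∈-lookup)
open import Data.List.Properties
  using (length-map; length-take; length-drop; length-++; length-reverse; drop-[]; map-∘;
         reverse-involutive; unfold-reverse; take++drop≡id)
open import Data.List.Relation.Binary.Sublist.Propositional
  using (_⊆_; []; _∷ʳ_; _∷_; ⊆-refl; ⊆-trans; minimum)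
open import Data.List.Relation.Binary.Sublist.Propositional.Properties
  using (All-resp-⊆; take-⊆; drop-⊆; ++⁺; reverse⁺)
open import Data.List.Relation.Unary.All as All using (All; []; _∷_)
import Data.List.Relation.Unary.All.Properties as All
open import Data.List.Relation.Unary.AllPairs as AllPairs using (AllPairs; []; _∷_; allPairs?)
import Data.List.Relation.Unary.AllPairs.Properties as AllPairs
open import Data.List.Relation.Unary.Any using (here; there; index)
open import Data.List.Relation.Unary.Any.Properties using (lookup-index)
open import Data.List.Relation.Unary.Linked as Linked using (Linked; []; [-]; _∷_)
open import Data.List.Relation.Unary.Linked.Properties using (Linked⇒AllPairs)
open import Data.List.Relation.Unary.Unique.Propositional using (Unique)
import Data.List.Relation.Unary.Unique.Propositional.Properties as Unique
open import Data.Nat.Base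
open import Data.Nat.Properties
open import Data.Nat.Tactic.RingSolver using (solve-∀)
open import Data.Product.Base using (∃; ∃₂; _×_; _,_; proj₁; proj₂)
open import Data.Rational.Base as ℚ using (ℚ; 0ℚ; 1ℚ)
import Data.Rational.Properties as ℚ
open import Data.Rational.Unnormalised.Base as ℚᵘ using (mkℚᵘ; *≤*)
import Data.Rational.Unnormalised.Properties as ℚᵘ
open import Data.Sum.Base as Sum using (_⊎_; inj₁; inj₂)
open import Data.Unit.Base using (⊤; tt)
open import Data.Vec.Base as Vec using ([]; _∷_)
import Data.Vec.Properties as Vec
open import Function.Base using (_∘_; flip; id)
open import Function.Definitions using (Injective)
open import Relation.Binary.Definitions using (tri<; tri≈; tri>)
open import Relation.Binary.PropositionalEquality
open import Relation.Nullary using (yes; no; ¬_; ¬?; does; _×-dec_; contradiction)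
open import Relation.Nullary.Decidable using (decidable-stable; dec-true)
open import Defs

private
  variable
    A : Set
    j k m n N M : ℕ

-- Highest differing binary digits

⌊n/2⌋-< : ∀ n → n < 2 * m → ⌊ n /2⌋ < m
⌊n/2⌋-< {m} n n<2m = ≰⇒> λ m≤h → <⇒≱ n<2m (begin
  2 * m                 ≡⟨ cong (m +_) (+-identityʳ m) ⟩
  m + m                 ≤⟨ +-mono-≤ m≤h (≤-trans m≤h (⌊n/2⌋≤⌈n/2⌉ n)) ⟩
  ⌊ n /2⌋ + ⌈ n /2⌉     ≡⟨ ⌊n/2⌋+⌈n/2⌉≡n n ⟩
  n                     ∎)
  where open ≤-Reasoning

-- Hence three increasing numbers never share a half, which keeps two consecutive differences from
-- both being 0.
⌊/2⌋-≡⇒≤suc : ∀ x z → ⌊ x /2⌋ ≡ ⌊ z /2⌋ → z ≤ suc x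
⌊/2⌋-≡⇒≤suc zero          zero          eq = z≤n
⌊/2⌋-≡⇒≤suc zero          (suc zero)    eq = s≤s z≤n
⌊/2⌋-≡⇒≤suc (suc zero)    zero          eq = z≤n
⌊/2⌋-≡⇒≤suc (suc zero)    (suc zero)    eq = s≤s z≤n
⌊/2⌋-≡⇒≤suc (suc (suc x)) zero          eq = z≤n
⌊/2⌋-≡⇒≤suc (suc (suc x)) (suc zero)    eq = s≤s z≤n
⌊/2⌋-≡⇒≤suc (suc (suc x)) (suc (suc z)) eq =
  s≤s (s≤s (⌊/2⌋-≡⇒≤suc x z (suc-injective eq)))

-- The position of the highest binary digit in which x and y differ, for
-- x ≢ y below 2 ^ N.
δ : ℕ → ℕ → ℕ → ℕ
δ zero    x y = 0
δ (suc N) x y with ⌊ x /2⌋ ≟ ⌊ y /2⌋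
... | yes _ = 0
... | no  _ = suc (δ N ⌊ x /2⌋ ⌊ y /2⌋)

half-< : ∀ {x y} → x < y → ⌊ x /2⌋ ≢ ⌊ y /2⌋ → ⌊ x /2⌋ < ⌊ y /2⌋
half-< x<y neq = ≤∧≢⇒< (⌊n/2⌋-mono (<⇒≤ x<y)) neq

δ-< : ∀ N {x y} → x < y → y < 2 ^ N → δ N x y < N
δ-< zero    x<y y<1 = contradiction (<-≤-trans x<y (s≤s⁻¹ y<1)) λ ()
δ-< (suc N) {x} {y} x<y y< with ⌊ x /2⌋ ≟ ⌊ y /2⌋
... | yes _  = z<s
... | no neq = s<s (δ-< N (half-< x<y neq) (⌊n/2⌋-< y y<))

-- At a common highest differing digit, `x < y` would make the digit of `y` a 1 and `y < z` would
-- make it a 0.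
δ-≢ : ∀ N {x y z} → x < y → y < z → z < 2 ^ N → δ N x y ≢ δ N y z
δ-≢ zero    x<y y<z z<1 eq = contradiction (<-≤-trans y<z (s≤s⁻¹ z<1)) λ ()
δ-≢ (suc N) {x} {y} {z} x<y y<z z< eq with ⌊ x /2⌋ ≟ ⌊ y /2⌋ | ⌊ y /2⌋ ≟ ⌊ z /2⌋
... | yes p | yes q = <⇒≱ (≤-<-trans x<y y<z) (⌊/2⌋-≡⇒≤suc x z (trans p q))
... | no p  | no q  = δ-≢ N (half-< x<y p) (half-< y<z q) (⌊n/2⌋-< z z<)
                        (suc-injective eq)

-- All three numbers agree above the larger position, and at that position only one of the two steps
-- changes the digit.
δ-⊔ : ∀ N {x y z} → x < y → y < z → z < 2 ^ N → δ N x z ≡ δ N x y ⊔ δ N y z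
δ-⊔ zero    x<y y<z z<1 = refl
δ-⊔ (suc N) {x} {y} {z} x<y y<z z<
  with ⌊ x /2⌋ ≟ ⌊ y /2⌋ | ⌊ y /2⌋ ≟ ⌊ z /2⌋ | ⌊ x /2⌋ ≟ ⌊ z /2⌋
... | yes p | yes q | yes _ = refl
... | yes p | yes q | no r  = contradiction (trans p q) r
... | yes p | no q  | yes r = contradiction (trans (sym p) r) q
... | yes p | no q  | no r  = cong (λ h → suc (δ N h ⌊ z /2⌋)) p
... | no p  | yes q | yes r = contradiction (trans r (sym q)) p
... | no p  | yes q | no r  = cong (λ h → suc (δ N ⌊ x /2⌋ h)) (sym q)
... | no p  | no q  | yes r = contradiction r
  (<⇒≢ (<-trans (half-< x<y p) (half-< y<z q)))
... | no p  | no q  | no r  = cong suc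
  (δ-⊔ N (half-< x<y p) (half-< y<z q) (⌊n/2⌋-< z z<))

-- Pairwise relations under sublists and reversal

AllPairs-resp-⊆ : ∀ {R : A → A → Set} {xs ys : List A} → xs ⊆ ys → AllPairs R ys → AllPairs R xs
AllPairs-resp-⊆ []         []       = []
AllPairs-resp-⊆ (y ∷ʳ τ)   (_ ∷ u)  = AllPairs-resp-⊆ τ u
AllPairs-resp-⊆ (refl ∷ τ) (px ∷ u) = All-resp-⊆ τ px ∷ AllPairs-resp-⊆ τ u

All-reverse : ∀ {P : A → Set} {xs} → All P xs → All P (reverse xs)
All-reverse []                     = []
All-reverse {xs = x ∷ xs} (p ∷ ps) rewrite unfold-reverse x xs =
  All.++⁺ (All-reverse ps) (p ∷ [])

AllPairs-reverse : ∀ {R : A → A → Set} {xs : List A} → AllPairs R xs → AllPairs (flip R) (reverse xs)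
AllPairs-reverse []                    = []
AllPairs-reverse {R = R} {x ∷ xs} (px ∷ u) rewrite unfold-reverse x xs =
  AllPairs.++⁺ (AllPairs-reverse u) ([] ∷ [])
    (All.map (_∷ []) (All-reverse px))

Increasing : List ℕ → Set
Increasing = AllPairs _<_

-- Unimodal sequences

module Unimodal {A : Set} (_≺_ : A → A → Set) where

  -- For `_>_` in place of `_<_` a valley is a peak, so one development serves both colours.
  NoValley : List A → Set
  NoValley (a ∷ b ∷ c ∷ ds) = ¬ (b ≺ a × b ≺ c) × NoValley (b ∷ c ∷ ds)
  NoValley _                = ⊤

  Comparable : List A → Set
  Comparable = Linked (λ a b → a ≺ b ⊎ b ≺ a)

  descending : ∀ {a b} ds → Comparable (a ∷ b ∷ ds) → NoValley (a ∷ b ∷ ds) → b ≺ a →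
               Linked (flip _≺_) (a ∷ b ∷ ds)
  descending []       _            _         b≺a = b≺a ∷ [-]
  descending (c ∷ ds) (_ ∷ p ∷ ps) (nv , nvs) b≺a with p
  ... | inj₁ b≺c = contradiction (b≺a , b≺c) nv
  ... | inj₂ c≺b = b≺a ∷ descending ds (p ∷ ps) nvs c≺b

  -- After a first descent, the absence of valleys forbids any later rise. The peak opens the second
  -- part.
  unimodal : ∀ ds → Comparable ds → NoValley ds →
             ∃ λ i → Linked _≺_ (take i ds) × Linked (flip _≺_) (drop i ds)
  unimodal []           _        _  = 0 , [] , []
  unimodal (a ∷ [])     _        _  = 0 , [] , [-]
  unimodal (a ∷ b ∷ ds) (p ∷ ps) nv with p
  ... | inj₂ b≺a = 0 , [] , descending ds (p ∷ ps) nv b≺a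
  ... | inj₁ a≺b with unimodal (b ∷ ds) ps (tail ds nv)
    where
    tail : ∀ ds → NoValley (a ∷ b ∷ ds) → NoValley (b ∷ ds)
    tail []      _  = tt
    tail (_ ∷ _) nv = proj₂ nv
  -- Index 0 for the tail means that `b` is the peak, which leaves `a` alone in front.
  ... | zero  , _ , l = 1 , [-] , l
  ... | suc i , r , l = suc (suc i) , a≺b ∷ r , l

-- Differences of vertex lists

module Differences (N : ℕ) where

  δs : List ℕ → List ℕ
  δs (x ∷ y ∷ xs) = δ N x y ∷ δs (y ∷ xs)
  δs _            = []

  length-δs : ∀ x xs → length (δs (x ∷ xs)) ≡ length xs
  length-δs x []       = refl
  length-δs x (y ∷ xs) = cong suc (length-δs y xs)

  δs-take : ∀ m xs → δs (take (suc m) xs) ≡ take m (δs xs)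
  δs-take zero    []           = refl
  δs-take zero    (x ∷ xs)     = refl
  δs-take (suc m) []           = refl
  δs-take (suc m) (x ∷ [])     = refl
  δs-take (suc m) (x ∷ y ∷ xs) = cong (δ N x y ∷_) (δs-take m (y ∷ xs))

  δs-drop : ∀ m xs → δs (drop m xs) ≡ drop m (δs xs)
  δs-drop zero    xs           = refl
  δs-drop (suc m) []           = refl
  δs-drop (suc m) (x ∷ [])     = cong δs (drop-[] m)
  δs-drop (suc m) (x ∷ y ∷ xs) = δs-drop m (y ∷ xs)

  IncreasingBelow : List ℕ → Set
  IncreasingBelow xs = Increasing xs × All (_< 2 ^ N) xs

  below-⊆ : ∀ {xs ys} → xs ⊆ ys → IncreasingBelow ys → IncreasingBelow xs
  below-⊆ τ (i , b) = AllPairs-resp-⊆ τ i , All-resp-⊆ τ b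

  All-δs-< : ∀ {xs} → IncreasingBelow xs → All (_< N) (δs xs)
  All-δs-< {[]}         _  = []
  All-δs-< {x ∷ []}     _  = []
  All-δs-< {x ∷ y ∷ xs} ib@((x<y ∷ _) ∷ _ , _ ∷ y< ∷ _) =
    δ-< N x<y y< ∷ All-δs-< (below-⊆ (x ∷ʳ ⊆-refl) ib)

  δs-comparable : ∀ {xs} → IncreasingBelow xs →
                  Linked (λ a b → a < b ⊎ b < a) (δs xs)
  δs-comparable {[]}             _ = []
  δs-comparable {_ ∷ []}         _ = []
  δs-comparable {_ ∷ _ ∷ []}     _ = [-]
  δs-comparable {x ∷ y ∷ z ∷ xs} ib@((x<y ∷ _) ∷ (y<z ∷ _) ∷ _ , _ ∷ _ ∷ z< ∷ _) =
    ≢⇒<⊎> (δ-≢ N x<y y<z z<) ∷ δs-comparable (below-⊆ (x ∷ʳ ⊆-refl) ib)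
    where
    ≢⇒<⊎> : ∀ {a b} → a ≢ b → a < b ⊎ b < a
    ≢⇒<⊎> {a} {b} a≢b with <-cmp a b
    ... | tri< a<b _ _ = inj₁ a<b
    ... | tri≈ _ a≡b _ = contradiction a≡b a≢b
    ... | tri> _ _ b<a = inj₂ b<a

  -- When the differences rise, δ between two vertices is the last difference
  -- between them, so that x and the right ends of the chosen differences will
  -- do; when they fall, it is the first one, and the left ends will do.
  sublist-of-rising : ∀ x xs → IncreasingBelow (x ∷ xs) → Increasing (δs (x ∷ xs)) →
    ∀ {zs} → zs ⊆ δs (x ∷ xs) → ∃ λ ws → ws ⊆ xs × δs (x ∷ ws) ≡ zs
  sublist-of-rising x []       ib _ [] = [] , [] , refl
  sublist-of-rising x (y ∷ ys) ib (p ∷ ps) (refl ∷ τ)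
    with sublist-of-rising y ys (below-⊆ (x ∷ʳ ⊆-refl) ib) ps τ
  ... | ws , σ , eq = y ∷ ws , refl ∷ σ , cong (δ N x y ∷_) eq
  sublist-of-rising x (y ∷ ys) ib (p ∷ ps) (_ ∷ʳ τ)
    with sublist-of-rising y ys (below-⊆ (x ∷ʳ ⊆-refl) ib) ps τ
  ... | []     , σ , eq = [] , minimum _ , eq
  ... | w ∷ ws , σ , refl
      with below-⊆ (refl ∷ refl ∷ σ) ib | All-resp-⊆ τ p
  ... | (x<y ∷ _) ∷ (y<w ∷ _) ∷ _ , _ ∷ _ ∷ w< ∷ _ | xy<yw ∷ _ =
    w ∷ ws , y ∷ʳ σ , cong (_∷ δs (w ∷ ws))
      (trans (δ-⊔ N x<y y<w w<) (m≤n⇒m⊔n≡n (<⇒≤ xy<yw)))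

  -- By `δ-⊔`, later differences enter `δ N x w` only through a maximum with the larger `δ N x y`.
  δ-const-of-falling : ∀ {x y ys} → IncreasingBelow (x ∷ y ∷ ys) →
    AllPairs _>_ (δs (x ∷ y ∷ ys)) → All (λ w → δ N x w ≡ δ N x y) (y ∷ ys)
  δ-const-of-falling {ys = []} _ _ = refl ∷ []
  δ-const-of-falling {x} {y} {z ∷ zs} ib@((x<y ∷ _) ∷ y<zs ∷ _ , _ ∷ _ ∷ zs<) ((xy>yz ∷ _) ∷ u) =
    refl ∷ All.zipWith step
      (All.zip (y<zs , zs<) , δ-const-of-falling (below-⊆ (x ∷ʳ ⊆-refl) ib) u)
    where
    step : ∀ {w} → (y < w × w < 2 ^ N) × δ N y w ≡ δ N y z → δ N x w ≡ δ N x y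
    step ((y<w , w<) , eq) = trans (δ-⊔ N x<y y<w w<)
      (m≥n⇒m⊔n≡m (≤-trans (≤-reflexive eq) (<⇒≤ xy>yz)))

  sublist-of-falling : ∀ x xs → IncreasingBelow (x ∷ xs) → AllPairs _>_ (δs (x ∷ xs)) →
    ∀ {zs} → zs ⊆ δs (x ∷ xs) → ∃₂ λ w ws → w ∷ ws ⊆ x ∷ xs × δs (w ∷ ws) ≡ zs
  sublist-of-falling x []       ib _ [] = x , [] , ⊆-refl , refl
  sublist-of-falling x (y ∷ ys) ib (p ∷ ps) (_ ∷ʳ τ)
    with sublist-of-falling y ys (below-⊆ (x ∷ʳ ⊆-refl) ib) ps τ
  ... | w , ws , σ , eq = w , ws , x ∷ʳ σ , eq
  sublist-of-falling x (y ∷ ys) ib (p ∷ ps) (refl ∷ τ)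
    with sublist-of-falling y ys (below-⊆ (x ∷ʳ ⊆-refl) ib) ps τ
  ... | w , ws , σ , refl with All-resp-⊆ σ (δ-const-of-falling ib (p ∷ ps))
  ... | eq ∷ _ = x , w ∷ ws , refl ∷ σ , cong (_∷ δs (w ∷ ws)) eq

-- Stepping up

-- The subsets of {0, …, N - 1} are encoded as increasing lists.
LowerBound : (k n N : ℕ) → Set
LowerBound k n N = ∃ λ (χ : List ℕ → Colour) →
  ∀ {xs} → Increasing xs → All (_< N) xs → n ≤ length xs → ∀ c → ¬ Homogeneous k χ c xs

weaken-size : m ≤ n → LowerBound k m N → LowerBound k n N
weaken-size m≤n (χ , lb) = χ , λ i b l → lb i b (≤-trans m≤n l)

-- Induction on a running lower bound `a`, which each entry raises by at least one.
increasing-length : ∀ {a xs} → a ≤ N → All (a ≤_) xs → Increasing xs → All (_< N) xs →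
                    length xs + a ≤ N
increasing-length {xs = []} a≤N _ _ _ = a≤N
increasing-length {N} {a} {x ∷ xs} _ (a≤x ∷ _) (p ∷ ps) (x<N ∷ b) = begin
  suc (length xs + a) ≤⟨ s≤s (+-monoʳ-≤ (length xs) a≤x) ⟩
  suc (length xs + x) ≡⟨ +-suc (length xs) x ⟨
  length xs + suc x   ≤⟨ increasing-length x<N p ps b ⟩
  N                   ∎
  where open ≤-Reasoning

turn : List ℕ → Colour
turn (a ∷ b ∷ _) with a <? b
... | yes _ = red
... | no  _ = blue
-- Edges have at least three vertices, hence two differences, so this value is arbitrary.
turn _ = red

turn-red : ∀ {a b ds} → turn (a ∷ b ∷ ds) ≡ red → a < b
turn-red {a} {b} eq with a <? b
... | yes p = p

turn-blue : ∀ {a b ds} → turn (a ∷ b ∷ ds) ≡ blue → ¬ a < b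
turn-blue {a} {b} eq with a <? b
... | no p = p

turn-peak : ∀ {a b ds} → a < b → turn (a ∷ b ∷ ds) ≡ red
turn-peak {a} {b} a<b with a <? b
... | yes _  = refl
... | no a≮b = contradiction a<b a≮b

turn-valley : ∀ {a b ds} → b < a → turn (a ∷ b ∷ ds) ≡ blue
turn-valley {a} {b} b<a with a <? b
... | yes a<b = contradiction b<a (<⇒≯ a<b)
... | no _    = refl

-- Triples coloured by the rise or fall of their differences

module _ (m : ℕ) where
  open Differences m

  rising-if-red : ∀ {xs} → Homogeneous 3 (turn ∘ δs) red xs → Linked _<_ (δs xs)
  rising-if-red {[]}             h = []
  rising-if-red {_ ∷ []}         h = []
  rising-if-red {_ ∷ _ ∷ []}     h = [-]
  rising-if-red {x ∷ y ∷ z ∷ xs} h =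
    turn-red {ds = δs (z ∷ [])} (h (x ∷ y ∷ z ∷ []) (refl ∷ refl ∷ refl ∷ minimum xs) refl)
      ∷ rising-if-red λ ws τ → h ws (x ∷ʳ τ)

  -- Blue only excludes a rise; that consecutive differences are distinct makes the fall strict.
  falling-if-blue : ∀ {xs} → IncreasingBelow xs → Homogeneous 3 (turn ∘ δs) blue xs →
                    Linked _>_ (δs xs)
  falling-if-blue {[]}             ib h = []
  falling-if-blue {_ ∷ []}         ib h = []
  falling-if-blue {_ ∷ _ ∷ []}     ib h = [-]
  falling-if-blue {x ∷ y ∷ z ∷ xs} ib h =
    fall (Linked.head (δs-comparable ib))
      ∷ falling-if-blue (below-⊆ (x ∷ʳ ⊆-refl) ib) λ ws τ → h ws (x ∷ʳ τ)
    where
    fall : δ m x y < δ m y z ⊎ δ m y z < δ m x y → δ m x y > δ m y z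
    fall (inj₂ xy>yz) = xy>yz
    fall (inj₁ xy<yz) = contradiction xy<yz (turn-blue {ds = δs (z ∷ [])}
      (h (x ∷ y ∷ z ∷ []) (refl ∷ refl ∷ refl ∷ minimum xs) refl))

  -- A homogeneous set of `2 + m` vertices would have `1 + m` strictly monotone differences, all
  -- below `m`.
  lowerBound₃ : LowerBound 3 (2 + m) (2 ^ m)
  lowerBound₃ = turn ∘ δs , none
    where
    too-long : ∀ {x xs ds} → suc m ≤ length xs → length ds ≡ length (δs (x ∷ xs)) →
               Increasing ds → All (_< m) ds → ⊥
    too-long {x} {xs} {ds} l eq i b = <⇒≱ l (begin
      length xs            ≡⟨ length-δs x xs ⟨
      length (δs (x ∷ xs)) ≡⟨ eq ⟨
      length ds            ≡⟨ +-identityʳ (length ds) ⟨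
      length ds + 0        ≤⟨ increasing-length z≤n (All.universal (λ _ → z≤n) ds) i b ⟩
      m                    ∎)
      where open ≤-Reasoning
    none : ∀ {xs} → Increasing xs → All (_< 2 ^ m) xs → 2 + m ≤ length xs → ∀ c →
           ¬ Homogeneous 3 (turn ∘ δs) c xs
    none {x ∷ xs} i b (s≤s l) red  h = too-long {x} {xs} l refl
      (Linked⇒AllPairs <-trans (rising-if-red h)) (All-δs-< (i , b))
    none {x ∷ xs} i b (s≤s l) blue h = too-long {x} {xs} l (length-reverse (δs (x ∷ xs)))
      (AllPairs-reverse (Linked⇒AllPairs (flip <-trans) (falling-if-blue (i , b) h)))
      (All-reverse (All-δs-< (i , b)))

-- The colouring of sets with one more vertex

module _ (χ : List ℕ → Colour) where

  -- The reversal lets `χ` see an increasing list. Differences that are not monotone turn first at a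
  -- peak if they start by rising, and at a valley if they start by falling, so `turn` need only
  -- compare the first two.
  colour : List ℕ → Colour
  colour ds with allPairs? _<?_ ds | allPairs? _>?_ ds
  ... | yes _ | _     = χ ds
  ... | no _  | yes _ = χ (reverse ds)
  ... | no _  | no _  = turn ds

  colour-rising : ∀ {ds} → Increasing ds → colour ds ≡ χ ds
  colour-rising {ds} p with allPairs? _<?_ ds | allPairs? _>?_ ds
  ... | yes _ | _ = refl
  ... | no ¬p | _ = contradiction p ¬p

  colour-falling : ∀ {a b ds} → AllPairs _>_ (a ∷ b ∷ ds) →
                   colour (a ∷ b ∷ ds) ≡ χ (reverse (a ∷ b ∷ ds))
  colour-falling {a} {b} {ds} p@((b<a ∷ _) ∷ _)
    with allPairs? _<?_ (a ∷ b ∷ ds) | allPairs? _>?_ (a ∷ b ∷ ds)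
  ... | yes ((a<b ∷ _) ∷ _) | _     = contradiction b<a (<⇒≯ a<b)
  ... | no _                | yes _ = refl
  ... | no _                | no ¬p = contradiction p ¬p

  colour-peak : ∀ {a b c ds} → a < b → c < b → colour (a ∷ b ∷ c ∷ ds) ≡ red
  colour-peak {a} {b} {c} {ds} a<b c<b
    with allPairs? _<?_ (a ∷ b ∷ c ∷ ds) | allPairs? _>?_ (a ∷ b ∷ c ∷ ds)
  ... | yes (_ ∷ (b<c ∷ _) ∷ _) | _                   = contradiction b<c (<⇒≯ c<b)
  ... | no _                    | yes ((b<a ∷ _) ∷ _) = contradiction b<a (<⇒≯ a<b)
  ... | no _                    | no _ = turn-peak {ds = c ∷ ds} a<b

  colour-valley : ∀ {a b c ds} → b < a → b < c → colour (a ∷ b ∷ c ∷ ds) ≡ blue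
  colour-valley {a} {b} {c} {ds} b<a b<c
    with allPairs? _<?_ (a ∷ b ∷ c ∷ ds) | allPairs? _>?_ (a ∷ b ∷ c ∷ ds)
  ... | yes ((a<b ∷ _) ∷ _) | _                       = contradiction b<a (<⇒≯ a<b)
  ... | no _                | yes (_ ∷ (c<b ∷ _) ∷ _) = contradiction b<c (<⇒≯ c<b)
  ... | no _                | no _ = turn-valley {ds = c ∷ ds} b<a

module _ {j n N : ℕ} (χ : List ℕ → Colour)
  (none : ∀ {xs} → Increasing xs → All (_< N) xs → n ≤ length xs → ∀ c →
          ¬ Homogeneous (3 + j) χ c xs)
  where
  open Differences N

  private
    χ⁺ : List ℕ → Colour
    χ⁺ = colour χ ∘ δs

  -- Any `3 + j` of the rising differences are the differences of some `4 + j` of the vertices, so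
  -- `χ` would inherit a homogeneous set.
  no-long-rise : ∀ {xs c} → IncreasingBelow xs → Homogeneous (4 + j) χ⁺ c xs →
                 Linked _<_ (δs xs) → n ≤ length (δs xs) → ⊥
  -- Here `n` is 0, and the empty list is vacuously homogeneous.
  no-long-rise {[]}     {c} ib h r l = none [] [] l c λ { _ [] () }
  no-long-rise {x ∷ xs} {c} ib h r l = none rise (All-δs-< ib) l c hom
    where
    rise : Increasing (δs (x ∷ xs))
    rise = Linked⇒AllPairs <-trans r
    hom : Homogeneous (3 + j) χ c (δs (x ∷ xs))
    hom zs τ len with sublist-of-rising x xs ib rise τ
    ... | ws , σ , refl = trans
      (sym (colour-rising χ (AllPairs-resp-⊆ τ rise)))
      (h (x ∷ ws) (refl ∷ σ) (cong suc (trans (sym (length-δs x ws)) len)))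

  no-long-fall : ∀ {xs c} → IncreasingBelow xs → Homogeneous (4 + j) χ⁺ c xs →
                 Linked _>_ (δs xs) → n ≤ length (δs xs) → ⊥
  no-long-fall {[]}     {c} ib h r l = none [] [] l c λ { _ [] () }
  no-long-fall {x ∷ xs} {c} ib h r l =
    none (AllPairs-reverse fall) (All-reverse (All-δs-< ib))
      (≤-trans l (≤-reflexive (sym (length-reverse (δs (x ∷ xs)))))) c hom
    where
    fall : AllPairs _>_ (δs (x ∷ xs))
    fall = Linked⇒AllPairs (flip <-trans) r
    falling-colour : ∀ {ds} → length ds ≡ 3 + j → AllPairs _>_ ds →
                     colour χ ds ≡ χ (reverse ds)
    falling-colour {_ ∷ _ ∷ _} _ p = colour-falling χ p
    hom : Homogeneous (3 + j) χ c (reverse (δs (x ∷ xs)))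
    hom zs τ len
      -- Reversing restores the order of the differences, in which `sublist-of-falling` finds the
      -- vertices.
      with subst (reverse zs ⊆_) (reverse-involutive (δs (x ∷ xs))) (reverse⁺ τ)
    ... | σ with sublist-of-falling x xs ib fall σ
    ... | w , ws , ρ , eq = begin
      χ zs                      ≡⟨ cong χ (reverse-involutive zs) ⟨
      χ (reverse (reverse zs))  ≡⟨ falling-colour len′ (AllPairs-resp-⊆ σ fall) ⟨
      colour χ (reverse zs)     ≡⟨ cong (colour χ) eq ⟨
      χ⁺ (w ∷ ws)               ≡⟨ h (w ∷ ws) ρ (cong suc (trans (sym (length-δs w ws))
                                     (trans (cong length eq) len′))) ⟩
      c                         ∎
      where
      open ≡-Reasoning
      len′ : length (reverse zs) ≡ 3 + j
      len′ = trans (length-reverse zs) len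

  -- A fixed tail pads any four vertices of ys to an edge, and a turn among these
  -- four decides its colour.
  four-then-tail : ∀ {ys tail c} → Homogeneous (4 + j) χ⁺ c (ys ++ tail) →
    length tail ≡ j → ∀ {x₁ x₂ x₃ x₄} → x₁ ∷ x₂ ∷ x₃ ∷ x₄ ∷ [] ⊆ ys →
    colour χ (δ N x₁ x₂ ∷ δ N x₂ x₃ ∷ δ N x₃ x₄ ∷ δs (x₄ ∷ tail)) ≡ c
  four-then-tail h len τ = h _ (++⁺ τ ⊆-refl) (cong (4 +_) len)

  -- Three consecutive differences come from four consecutive vertices.
  no-valley : ∀ _≺_ {ys} →
    (∀ {x₁ x₂ x₃ x₄} → x₁ ∷ x₂ ∷ x₃ ∷ x₄ ∷ [] ⊆ ys →
      ¬ (δ N x₂ x₃ ≺ δ N x₁ x₂ × δ N x₂ x₃ ≺ δ N x₃ x₄)) →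
    Unimodal.NoValley _≺_ (δs ys)
  no-valley _≺_ {[]}                 h = tt
  no-valley _≺_ {_ ∷ []}             h = tt
  no-valley _≺_ {_ ∷ _ ∷ []}         h = tt
  no-valley _≺_ {_ ∷ _ ∷ _ ∷ []}     h = tt
  no-valley _≺_ {_ ∷ _ ∷ _ ∷ _ ∷ ys} h =
    h (refl ∷ refl ∷ refl ∷ refl ∷ minimum ys) , no-valley _≺_ λ τ → h (_ ∷ʳ τ)

  -- One of the two runs contains at least `n` of the differences.
  no-long-unimodal : ∀ {xs c} i → IncreasingBelow xs → Homogeneous (4 + j) χ⁺ c xs →
    n + n ≤ length (δs xs) →
    ¬ (Linked _<_ (take i (δs xs)) × Linked _>_ (drop i (δs xs)) ⊎
       Linked _>_ (take i (δs xs)) × Linked _<_ (drop i (δs xs)))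
  no-long-unimodal {xs} {c} i ib h l =
    λ { (inj₁ (r , f)) → no-runs (inj₁ r) (inj₂ f)
      ; (inj₂ (f , r)) → no-runs (inj₂ f) (inj₁ r) }
    where
    Run : List ℕ → Set
    Run ds = Linked _<_ ds ⊎ Linked _>_ ds
    no-run : ∀ {ys ds} → ys ⊆ xs → δs ys ≡ ds → n ≤ length ds → ¬ Run ds
    no-run τ refl l (inj₁ r) = no-long-rise (below-⊆ τ ib) (λ ws σ → h ws (⊆-trans σ τ)) r l
    no-run τ refl l (inj₂ r) = no-long-fall (below-⊆ τ ib) (λ ws σ → h ws (⊆-trans σ τ)) r l
    total : length (take i (δs xs)) + length (drop i (δs xs)) ≡ length (δs xs)
    total = trans (sym (length-++ (take i (δs xs)))) (cong length (take++drop≡id i (δs xs)))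
    no-runs : Run (take i (δs xs)) → ¬ Run (drop i (δs xs))
    no-runs r r′ = <⇒≱ (+-mono-<
      -- The first `i` differences belong to `suc i` vertices; the vertex at the cut is shared by
      -- both runs.
      (≰⇒> λ n≤ → no-run (take-⊆ (suc i) xs) (δs-take i xs) n≤ r)
      (≰⇒> λ n≤ → no-run (drop-⊆ i xs) (δs-drop i xs) n≤ r′))
      (≤-trans l (≤-reflexive (sym total)))

  no-homogeneous : ∀ {xs} → IncreasingBelow xs → suc (n + n) + j ≤ length xs → ∀ c →
                   ¬ Homogeneous (4 + j) χ⁺ c xs
  no-homogeneous {xs} ib l = by-colour
    where
    s : ℕ
    -- One vertex more than the `n + n` differences wanted; the `j` vertices after these form the
    -- padding.
    s = suc (n + n)
    head tail : List ℕ
    head = take s xs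
    tail = take j (drop s xs)
    head++tail⊆xs : head ++ tail ⊆ xs
    head++tail⊆xs = subst (head ++ tail ⊆_) (take++drop≡id s xs)
      (++⁺ ⊆-refl (take-⊆ j (drop s xs)))
    ib′ : IncreasingBelow head
    ib′ = below-⊆ (take-⊆ s xs) ib
    length-head : length head ≡ s
    length-head = trans (length-take s xs) (m≤n⇒m⊓n≡m (≤-trans (m≤m+n s j) l))
    length-tail : length tail ≡ j
    length-tail = trans (length-take j (drop s xs)) (m≤n⇒m⊓n≡m (begin
      j                  ≡⟨ m+n∸m≡n s j ⟨
      s + j ∸ s          ≤⟨ ∸-monoˡ-≤ s l ⟩
      length xs ∸ s      ≡⟨ length-drop s xs ⟨
      length (drop s xs) ∎))
      where open ≤-Reasoning
    long : ∀ ys → length ys ≡ s → n + n ≤ length (δs ys)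
    long (y ∷ ys) eq = ≤-reflexive (trans (sym (suc-injective eq)) (sym (length-δs y ys)))
    four : ∀ {c x₁ x₂ x₃ x₄} → Homogeneous (4 + j) χ⁺ c xs → x₁ ∷ x₂ ∷ x₃ ∷ x₄ ∷ [] ⊆ head →
           colour χ (δ N x₁ x₂ ∷ δ N x₂ x₃ ∷ δ N x₃ x₄ ∷ δs (x₄ ∷ tail)) ≡ c
    four h = four-then-tail (λ ws τ → h ws (⊆-trans τ head++tail⊆xs)) length-tail
    impossible : red ≢ blue
    impossible ()
    by-colour : ∀ c → ¬ Homogeneous (4 + j) χ⁺ c xs
    -- A valley among the differences of `head` would give a padded edge that is blue.
    by-colour red h with Unimodal.unimodal _<_ (δs head) (δs-comparable ib′)
      (no-valley _<_ λ τ (p , q) → impossible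
        (trans (sym (four h τ)) (colour-valley χ p q)))
    ... | i , r , f = no-long-unimodal i ib′ (λ ws τ → h ws (⊆-trans τ (take-⊆ s xs)))
      (long head length-head) (inj₁ (r , f))
    -- Symmetrically, a peak is a valley for `_>_` and would give a red edge.
    by-colour blue h with Unimodal.unimodal _>_ (δs head) (Linked.map Sum.swap (δs-comparable ib′))
      (no-valley _>_ λ τ (p , q) → impossible
        (trans (sym (colour-peak χ p q)) (four h τ)))
    ... | i , f , r = no-long-unimodal i ib′ (λ ws τ → h ws (⊆-trans τ (take-⊆ s xs)))
      (long head length-head) (inj₂ (f , r))

lowerBound-stepUp : LowerBound (3 + j) n N → LowerBound (4 + j) (suc (n + n) + j) (2 ^ N)
lowerBound-stepUp {N = N} (χ , none) =
  colour χ ∘ Differences.δs N , λ i b → no-homogeneous χ none (i , b)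

-- An edge takes the colour of what is left after removing its least vertex; the least vertex of a
-- homogeneous set extends every edge among the others.
lowerBound-suc : LowerBound k n N → LowerBound (suc k) (suc n) N
lowerBound-suc {k} (χ , none) = (λ xs → χ (drop 1 xs)) ,
  λ { {x ∷ xs} (_ ∷ i) (_ ∷ b) (s≤s l) c h →
      none i b l c λ zs τ len → h (x ∷ zs) (refl ∷ τ) (cong suc len) }

lowerBound-+ : ∀ i → LowerBound k n N → LowerBound (i + k) (i + n) N
lowerBound-+ zero    lb = lb
lowerBound-+ (suc i) lb = lowerBound-suc (lowerBound-+ i lb)

-- Two steps up lead from triples to 5-sets, the sizes being `2 + m`, `2 * m + 5` and `4 * m + 12`;
-- the remaining `i` raises of the uniformity keep `N`.
lowerBound-tower : ∀ i m → LowerBound (i + 5) (i + (4 * m + 12)) (2 ^ (2 ^ (2 ^ m)))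
lowerBound-tower i m = lowerBound-+ i (subst (λ n → LowerBound 5 n (2 ^ (2 ^ (2 ^ m)))) (eq m)
  (lowerBound-stepUp {j = 1} (lowerBound-stepUp {j = 0} (lowerBound₃ m))))
  where
  eq : ∀ m → suc ((suc ((2 + m) + (2 + m)) + 0) + (suc ((2 + m) + (2 + m)) + 0)) + 1
           ≡ 4 * m + 12
  eq = solve-∀

-- Counting with duplicate-free lists

lookup-injective : ∀ {xs : List A} → Unique xs → Injective _≡_ _≡_ (lookup xs)
lookup-injective (p ∷ u) {zero}  {zero}  eq = refl
lookup-injective (p ∷ u) {zero}  {suc j} eq = contradiction eq (All.lookup p (∈-lookup j))
lookup-injective (p ∷ u) {suc i} {zero}  eq = contradiction (sym eq) (All.lookup p (∈-lookup i))
lookup-injective (p ∷ u) {suc i} {suc j} eq = cong suc (lookup-injective u eq)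

unique-length-≤ : ∀ {xs ys : List A} → Unique xs → (∀ {x} → x ∈ xs → x ∈ ys) →
                  length xs ≤ length ys
unique-length-≤ {xs = xs} {ys} u sub = injective⇒≤ {f = λ i → index (sub (∈-lookup {xs = xs} i))}
  λ {i} {j} eq → lookup-injective u (begin
    lookup xs i                       ≡⟨ lookup-index (sub (∈-lookup i)) ⟩
    lookup ys (index (sub (∈-lookup i))) ≡⟨ cong (lookup ys) eq ⟩
    lookup ys (index (sub (∈-lookup j))) ≡⟨ lookup-index (sub (∈-lookup j)) ⟨
    lookup xs j                       ∎)
  where open ≡-Reasoning

-- Images of subsets

∈-elements⁺ : ∀ {x} (e : Subset n) → x ∈ˢ e → x ∈ elements e
∈-elements⁺ (inside  ∷ e) Vec.here      = here refl
∈-elements⁺ (inside  ∷ e) (Vec.there p) = there (∈-map⁺ suc (∈-elements⁺ e p))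
∈-elements⁺ (outside ∷ e) (Vec.there p) = ∈-map⁺ suc (∈-elements⁺ e p)

∈-elements⁻ : ∀ {x} (e : Subset n) → x ∈ elements e → x ∈ˢ e
∈-elements⁻ (inside  ∷ e) (here refl) = Vec.here
∈-elements⁻ (inside  ∷ e) (there p) with ∈-map⁻ suc p
... | y , q , refl = Vec.there (∈-elements⁻ e q)
∈-elements⁻ (outside ∷ e) p with ∈-map⁻ suc p
... | y , q , refl = Vec.there (∈-elements⁻ e q)

length-elements : ∀ (e : Subset n) → length (elements e) ≡ ∣ e ∣
length-elements []            = refl
length-elements (inside  ∷ e) = cong suc (trans (length-map suc (elements e)) (length-elements e))
length-elements (outside ∷ e) = trans (length-map suc (elements e)) (length-elements e)

elements-increasing : ∀ (e : Subset n) → AllPairs Fin._<_ (elements e)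
elements-increasing []            = []
elements-increasing (inside  ∷ e) =
  All.map⁺ (All.universal (λ _ → z<s) (elements e)) ∷
  AllPairs.map⁺ (AllPairs.map s<s (elements-increasing e))
elements-increasing (outside ∷ e) = AllPairs.map⁺ (AllPairs.map s<s (elements-increasing e))

elements-unique : ∀ (e : Subset n) → Unique (elements e)
elements-unique e = AllPairs.map (λ i<j i≡j → <-irrefl (cong toℕ i≡j) i<j) (elements-increasing e)

-- A general `f` absorbs the `suc` by which `elements` shifts the tail, so that the induction goes
-- through.
sublist-of-elements : ∀ (f : Fin n → A) (e : Subset n) {zs} → zs ⊆ map f (elements e) →
  ∃ λ d → (∀ {i} → i ∈ˢ d → i ∈ˢ e) × map f (elements d) ≡ zs
sublist-of-elements f []            [] = [] , id , refl
sublist-of-elements f (outside ∷ e) τ rewrite sym (map-∘ {g = f} {f = suc} (elements e))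
  with sublist-of-elements (f ∘ suc) e τ
... | d , d⊆e , eq = outside ∷ d , (λ { (Vec.there p) → Vec.there (d⊆e p) }) ,
  trans (sym (map-∘ (elements d))) eq
sublist-of-elements f (inside ∷ e) (_ ∷ʳ τ) rewrite sym (map-∘ {g = f} {f = suc} (elements e))
  with sublist-of-elements (f ∘ suc) e τ
... | d , d⊆e , eq = outside ∷ d , (λ { (Vec.there p) → Vec.there (d⊆e p) }) ,
  trans (sym (map-∘ (elements d))) eq
sublist-of-elements f (inside ∷ e) (refl ∷ τ) rewrite sym (map-∘ {g = f} {f = suc} (elements e))
  with sublist-of-elements (f ∘ suc) e τ
... | d , d⊆e , eq = inside ∷ d ,
  (λ { Vec.here → Vec.here ; (Vec.there p) → Vec.there (d⊆e p) }) ,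
  cong (f zero ∷_) (trans (sym (map-∘ (elements d))) eq)

-- Both sizes are lengths of duplicate-free lists with the same members.
∣image∣ : ∀ {φ : Fin n → Fin N} → Injective _≡_ _≡_ φ → ∀ e → ∣ image φ e ∣ ≡ ∣ e ∣
∣image∣ {φ = φ} inj e = begin
  ∣ image φ e ∣                ≡⟨ length-elements (image φ e) ⟨
  length (elements (image φ e)) ≡⟨ ≤-antisym
    (unique-length-≤ (elements-unique (image φ e)) to)
    (unique-length-≤ (Unique.map⁺ inj (elements-unique e)) from) ⟩
  length (map φ (elements e))  ≡⟨ length-map φ (elements e) ⟩
  length (elements e)          ≡⟨ length-elements e ⟩
  ∣ e ∣                        ∎
  where
  open ≡-Reasoning
  to : ∀ {x} → x ∈ elements (image φ e) → x ∈ map φ (elements e)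
  to p with ∈-image⁻ φ (∈-elements⁻ (image φ e) p)
  ... | i , q , refl = ∈-map⁺ φ (∈-elements⁺ e q)
  from : ∀ {x} → x ∈ map φ (elements e) → x ∈ elements (image φ e)
  from p with ∈-map⁻ φ p
  ... | i , q , refl = ∈-elements⁺ (image φ e) (∈-image⁺ φ (∈-elements⁻ e q))

image-id : ∀ (e : Subset n) → image id e ≡ e
image-id e = ⊆-antisym (λ p → case (∈-image⁻ id p)) (∈-image⁺ id)
  where
  case : ∀ {j} → (∃ λ i → i ∈ˢ e × i ≡ j) → j ∈ˢ e
  case (i , p , refl) = p

image-∘ : ∀ (ψ : Fin N → Fin M) (φ : Fin n → Fin N) e → image (ψ ∘ φ) e ≡ image ψ (image φ e)
image-∘ ψ φ e = ⊆-antisym to from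
  where
  to : ∀ {j} → j ∈ˢ image (ψ ∘ φ) e → j ∈ˢ image ψ (image φ e)
  to p with ∈-image⁻ (ψ ∘ φ) p
  ... | i , q , refl = ∈-image⁺ ψ (∈-image⁺ φ q)
  from : ∀ {j} → j ∈ˢ image ψ (image φ e) → j ∈ˢ image (ψ ∘ φ) e
  from p with ∈-image⁻ ψ p
  ... | _ , q , refl with ∈-image⁻ φ q
  ... | i , r , refl = ∈-image⁺ (ψ ∘ φ) r

preimage : (Fin n → Fin N) → Subset N → Subset n
preimage φ d = Vec.tabulate (Vec.lookup d ∘ φ)

image-preimage : ∀ (φ : Fin n → Fin N) d → (∀ {j} → j ∈ˢ d → j ∈ˢ image φ full) →
                 image φ (preimage φ d) ≡ d
image-preimage φ d d⊆ = ⊆-antisym to from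
  where
  to : ∀ {j} → j ∈ˢ image φ (preimage φ d) → j ∈ˢ d
  to p with ∈-image⁻ φ p
  ... | i , q , refl = Vec.lookup⇒[]= (φ i) d
    (trans (sym (Vec.lookup∘tabulate (Vec.lookup d ∘ φ) i)) (Vec.[]=⇒lookup q))
  from : ∀ {j} → j ∈ˢ d → j ∈ˢ image φ (preimage φ d)
  from p with ∈-image⁻ φ (d⊆ p)
  ... | i , _ , refl = ∈-image⁺ φ (Vec.lookup⇒[]= i (preimage φ d)
    (trans (Vec.lookup∘tabulate (Vec.lookup d ∘ φ) i) (Vec.[]=⇒lookup p)))

-- Ramsey numbers

↪-trans : ∀ {F : KGraph k n} {G : KGraph k N} {H : KGraph k M} → F ↪ G → G ↪ H → F ↪ H
↪-trans {H = H} (φ , φ-inj , f) (ψ , ψ-inj , g) =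
  ψ ∘ φ , φ-inj ∘ ψ-inj , λ e p → subst (Edge H) (sym (image-∘ ψ φ e)) (g (image φ e) (f e p))

edges-⊆⇒↪ : ∀ {G H : KGraph k n} → (∀ e → Edge G e → Edge H e) → G ↪ H
edges-⊆⇒↪ {H = H} sub = id , id , λ e p → subst (Edge H) (sym (image-id e)) (sub e p)

R⟶ : (H : KGraph k n) → R H ⟶ H
R⟶ H = proj₁ (proj₂ (ramseyNumber H))

R-least : ∀ {H : KGraph k n} → N ⟶ H → R H ≤ N
R-least {H = H} = proj₂ (proj₂ (ramseyNumber H)) _

R-mono : ∀ {G : KGraph k n} {H : KGraph k N} → G ↪ H → R G ≤ R H
R-mono {G = G} {H} ι = R-least {H = G} λ χ →
  let c , κ = R⟶ H χ in c , ↪-trans {F = G} {H} {χ restrictedTo c} ι κ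

R-K-mono : ∀ k n → R (K k n) ≤ R (K k (suc n))
R-K-mono k n = R-mono {G = K k n} {K k (suc n)}
  (inject₁ , inject₁-injective , λ e p → trans (∣image∣ inject₁-injective e) p)

-- The copy found in the all-red colouring is in particular an injection of vertices.
n≤R : ∀ (H : KGraph k n) → n ≤ R H
n≤R H = injective⇒≤ (proj₁ (proj₂ (proj₂ (R⟶ H λ _ _ → red))))

-- The vertices of a monochromatic copy would form a homogeneous list: a sublist of length `k` is a
-- subset `d` of the image, and its preimage is an edge of the complete graph.
¬arrow : LowerBound k n N → M ≤ N → ¬ M ⟶ K k n
¬arrow {k} {n} {N} {M} (χ , none) M≤N arrow with arrow (λ e _ → χ (map toℕ (elements e)))
... | c , φ , inj , mono = none
  (AllPairs.map⁺ (elements-increasing (image φ full)))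
  (All.map⁺ (All.universal (λ i → <-≤-trans (toℕ<n i) M≤N) (elements (image φ full))))
  (≤-reflexive (begin
    n                                              ≡⟨ ∣⊤∣≡n n ⟨
    ∣ full {n} ∣                                   ≡⟨ ∣image∣ inj full ⟨
    ∣ image φ full ∣                               ≡⟨ length-elements (image φ full) ⟨
    length (elements (image φ full))               ≡⟨ length-map toℕ (elements (image φ full)) ⟨
    length (map toℕ (elements (image φ full)))     ∎))
  c hom
  where
  open ≡-Reasoning
  hom : Homogeneous k χ c (map toℕ (elements (image φ full)))
  hom zs τ len with sublist-of-elements toℕ (image φ full) τ
  ... | d , d⊆ , refl =
    subst (λ d → χ (map toℕ (elements d)) ≡ c) pre (proj₂ (mono (preimage φ d) (begin
      ∣ preimage φ d ∣                ≡⟨ ∣image∣ inj (preimage φ d) ⟨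
      ∣ image φ (preimage φ d) ∣      ≡⟨ cong ∣_∣ pre ⟩
      ∣ d ∣                           ≡⟨ length-elements d ⟨
      length (elements d)             ≡⟨ length-map toℕ (elements d) ⟨
      length (map toℕ (elements d))   ≡⟨ len ⟩
      k                               ∎)))
    where pre = image-preimage φ d d⊆

lowerBound⇒≤R : LowerBound k n N → N ≤ R (K k n)
lowerBound⇒≤R {k} {n} lb = ≮⇒≥ λ R<N → ¬arrow lb (<⇒≤ R<N) (R⟶ (K k n))

-- Encoding of k-graphs by one bit for each of the n ^ k tuples of vertices

enumerate : ∀ (e : Subset n) → ∣ e ∣ ≡ k → ∃ λ (t : Fin k → Fin n) → image t full ≡ e
enumerate {n} e card = go (trans (length-elements e) card)
  where
  to : ∀ {j} → j ∈ˢ image (lookup (elements e)) full → j ∈ˢ e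
  to p with ∈-image⁻ (lookup (elements e)) p
  ... | i , _ , refl = ∈-elements⁻ e (∈-lookup i)
  from : ∀ {j} → j ∈ˢ e → j ∈ˢ image (lookup (elements e)) full
  from p = subst (_∈ˢ image (lookup (elements e)) full) (sym (lookup-index (∈-elements⁺ e p)))
    (∈-image⁺ (lookup (elements e)) ∈⊤)
  go : ∀ {k} → length (elements e) ≡ k → ∃ λ (t : Fin k → Fin n) → image t full ≡ e
  go refl = lookup (elements e) , ⊆-antisym to from

edgeSet : ∀ k n → Fin (n ^ k) → Subset n
edgeSet k n i = image (finToFun {n} {k} i) full

-- The size condition discards tuples with repeated entries; among the orderings of an edge, one set
-- bit suffices.
decode : ∀ k n → (Fin (n ^ k) → Fin 2) → KGraph k n
decode k n b = record
  { Edge    = λ e → ∣ e ∣ ≡ k × ∃ λ i → b i ≡ suc zero × edgeSet k n i ≡ e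
  ; edge?   = λ e → (∣ e ∣ ≟ k) ×-dec any? λ i →
                (b i ≟ᶠ suc zero) ×-dec Vec.≡-dec Bool._≟_ (edgeSet k n i) e
  ; uniform = proj₁
  }

encode : KGraph k n → Fin (n ^ k) → Fin 2
encode {k} {n} H i = if does (edge? H (edgeSet k n i)) then suc zero else zero

-- The edge sets coincide, so each graph embeds in the other. Agreement of `b` is pointwise because
-- `finToFun-funToFin` provides no more.
decode-encode : ∀ (H : KGraph k n) {b} → (∀ i → b i ≡ encode H i) → R H ≡ R (decode k n b)
decode-encode {k} {n} H {b} b≗ = ≤-antisym
  (R-mono {G = H} {decode k n b} (edges-⊆⇒↪ {G = H} {decode k n b} to))
  (R-mono {G = decode k n b} {H} (edges-⊆⇒↪ {G = decode k n b} {H} from))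
  where
  to : ∀ e → Edge H e → Edge (decode k n b) e
  to e p with enumerate e (uniform H p)
  ... | t , eq = uniform H p , funToFin t ,
      trans (b≗ (funToFin t)) (cong (if_then suc zero else zero)
        (dec-true (edge? H (edgeSet k n (funToFin t))) (subst (Edge H) (sym eq′) p))) ,
      eq′
    where
    eq′ : edgeSet k n (funToFin t) ≡ e
    eq′ = trans (image-cong (finToFun-funToFin t) full) eq
  from : ∀ e → Edge (decode k n b) e → Edge H e
  from e (_ , i , bi , refl) with edge? H (edgeSet k n i) | b≗ i
  ... | yes p | _  = p
  ... | no  _ | eq with trans (sym bi) eq
  ...   | ()

ramseyValues : ∀ k n → ∃ λ (v : Fin (2 ^ (n ^ k)) → ℕ) → ∀ (H : KGraph k n) → ∃ λ i → R H ≡ v i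
ramseyValues k n = (λ i → R (decode k n (finToFun {2} {n ^ k} i))) ,
  λ H → funToFin (encode H) , decode-encode H (finToFun-funToFin (encode H))

-- Pigeonhole for the q + 1 disjoint intervals from n ^ (1 + 2 j) to n ^ (3 + 2 j).
gap : ∀ q n .{{_ : NonZero n}} (v : Fin q → ℕ) →
  ∃ λ j → j ≤ q × ∀ i → v i * n ≤ n ^ (2 + j * 2) ⊎ n * n ^ (2 + j * 2) ≤ v i
gap q n v with any? (λ (j : Fin (suc q)) → ¬? (any? λ i →
    (n ^ (2 + toℕ j * 2) <? v i * n) ×-dec (v i <? n * n ^ (2 + toℕ j * 2))))
... | yes (j , ¬hit) = toℕ j , toℕ≤pred[n] j , missed
  where
  missed : ∀ i → v i * n ≤ n ^ (2 + toℕ j * 2) ⊎ n * n ^ (2 + toℕ j * 2) ≤ v i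
  missed i with n ^ (2 + toℕ j * 2) <? v i * n | v i <? n * n ^ (2 + toℕ j * 2)
  ... | no p  | _     = inj₁ (≮⇒≥ p)
  ... | yes _ | no p  = inj₂ (≮⇒≥ p)
  ... | yes lo | yes hi = contradiction (i , lo , hi) ¬hit
... | no allHit = contradiction (pigeonhole (n<1+n q) (proj₁ ∘ hit)) collision
  where
  Hit : Fin (suc q) → Fin q → Set
  Hit j i = n ^ (2 + toℕ j * 2) < v i * n × v i < n * n ^ (2 + toℕ j * 2)
  hit : ∀ j → ∃ (Hit j)
  hit j = decidable-stable (any? λ i → (_ <? _) ×-dec (_ <? _)) λ ¬p → allHit (j , ¬p)
  disjoint : ∀ {a b} i → a < b → v i < n * n ^ (2 + a * 2) → ¬ n ^ (2 + b * 2) < v i * n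
  disjoint {a} {b} i a<b hi lo = <-irrefl refl (begin-strict
    n ^ (2 + b * 2)           <⟨ lo ⟩
    v i * n                   ≡⟨ *-comm (v i) n ⟩
    n * v i                   ≤⟨ *-monoʳ-≤ n (<⇒≤ hi) ⟩
    n ^ (2 + (2 + a * 2))     ≤⟨ ^-monoʳ-≤ n (+-monoʳ-≤ 2 (*-monoˡ-≤ 2 a<b)) ⟩
    n ^ (2 + b * 2)           ∎)
    where open ≤-Reasoning
  collision : ¬ ∃₂ λ i j → i Fin.< j × proj₁ (hit i) ≡ proj₁ (hit j)
  collision (i , j , i<j , eq) = disjoint (proj₁ (hit i)) i<j (proj₂ (proj₂ (hit i)))
    (subst (λ x → n ^ (2 + toℕ j * 2) < v x * n) (sym eq) (proj₁ (proj₂ (hit j))))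

-- Growth

n<2^n : ∀ n → n < 2 ^ n
n<2^n zero    = z<s
n<2^n (suc n) = +-mono-≤ (m^n>0 2 n) (≤-trans (n<2^n n) (≤-reflexive (sym (+-identityʳ (2 ^ n)))))

n*n≤2^n : ∀ s → (4 + s) * (4 + s) ≤ 2 ^ (4 + s)
n*n≤2^n zero    = ≤-refl
n*n≤2^n (suc s) = begin
  (5 + s) * (5 + s)                         ≤⟨ m≤m+n _ (7 + s * s + 6 * s) ⟩
  (5 + s) * (5 + s) + (7 + s * s + 6 * s)   ≡⟨ eq s ⟩
  2 * ((4 + s) * (4 + s))                   ≤⟨ *-monoʳ-≤ 2 (n*n≤2^n s) ⟩
  2 ^ (5 + s)                               ∎
  where
  open ≤-Reasoning
  eq : ∀ s → (5 + s) * (5 + s) + (7 + s * s + 6 * s) ≡ 2 * ((4 + s) * (4 + s))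
  eq = solve-∀

between-powers : ∀ b n → 2 ^ b ≤ n → ∃ λ t → b ≤ t × 2 ^ t ≤ n × n < 2 ^ suc t
between-powers b n 2^b≤n = search n (<-≤-trans (n<2^n n) (^-monoʳ-≤ 2 (m≤n+m n b)))
  where
  search : ∀ d → n < 2 ^ (b + d) → ∃ λ t → b ≤ t × 2 ^ t ≤ n × n < 2 ^ suc t
  search zero    p = contradiction 2^b≤n (<⇒≱ (subst (λ e → n < 2 ^ e) (+-identityʳ b) p))
  search (suc d) p with 2 ^ (b + d) ≤? n
  ... | yes q = b + d , m≤m+n b d , q , subst (λ e → n < 2 ^ e) (+-suc b d) p
  ... | no ¬q = search d (≰⇒> ¬q)

n^e≤2^ : ∀ n e {b} → n * e ≤ b → n ^ e ≤ 2 ^ b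
n^e≤2^ n e {b} ne≤b = begin
  n ^ e         ≤⟨ ^-monoˡ-≤ e (<⇒≤ (n<2^n n)) ⟩
  (2 ^ n) ^ e   ≡⟨ ^-*-assoc 2 n e ⟩
  2 ^ (n * e)   ≤⟨ ^-monoʳ-≤ 2 ne≤b ⟩
  2 ^ b         ∎
  where open ≤-Reasoning

exponent-bound : ∀ n p {b} → n + (2 + p) ≤ b → n * (2 + 2 ^ p * 2) ≤ 2 ^ b
exponent-bound n p {b} h = begin
  n * (2 + 2 ^ p * 2)               ≤⟨ *-mono-≤ (<⇒≤ (n<2^n n)) (+-monoˡ-≤ _ (*-monoˡ-≤ 2 (m^n>0 2 p))) ⟩
  2 ^ n * (2 ^ p * 2 + 2 ^ p * 2)   ≡⟨ cong (2 ^ n *_) (eq (2 ^ p)) ⟩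
  2 ^ n * 2 ^ (2 + p)               ≡⟨ ^-distribˡ-+-* 2 n (2 + p) ⟨
  2 ^ (n + (2 + p))                 ≤⟨ ^-monoʳ-≤ 2 h ⟩
  2 ^ b                             ∎
  where
  open ≤-Reasoning
  eq : ∀ x → x * 2 + x * 2 ≡ 2 * (2 * x)
  eq = solve-∀

-- Each of the three summands is at most `n ^ k * n`, and `4 ≤ n` absorbs their number into one more
-- factor `n`.
power-bound : ∀ k n b {e} → 4 ≤ n → n ≤ 2 ^ b → b * (2 + k) ≤ e → n + (2 + n ^ k) ≤ 2 ^ e
power-bound k n b {e} 4≤n n≤ h = begin
  n + (2 + p)               ≤⟨ +-mono-≤ n≤pn (+-mono-≤ (≤-trans 2≤n n≤pn) (m≤m*n p n)) ⟩
  p * n + (p * n + p * n)   ≤⟨ +-monoʳ-≤ (p * n) (+-monoʳ-≤ (p * n) (m≤m+n (p * n) (p * n + 0))) ⟩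
  4 * (p * n)               ≤⟨ *-monoˡ-≤ (p * n) 4≤n ⟩
  n * (p * n)               ≡⟨ cong (n *_) (*-comm p n) ⟩
  n ^ (2 + k)               ≤⟨ ^-monoˡ-≤ (2 + k) n≤ ⟩
  (2 ^ b) ^ (2 + k)         ≡⟨ ^-*-assoc 2 b (2 + k) ⟩
  2 ^ (b * (2 + k))         ≤⟨ ^-monoʳ-≤ 2 h ⟩
  2 ^ e                     ∎
  where
  open ≤-Reasoning
  p = n ^ k
  instance
    n≢0 : NonZero n
    n≢0 = >-nonZero (≤-trans (s≤s z≤n) 4≤n)
    p≢0 : NonZero p
    p≢0 = m^n≢0 n k
  n≤pn : n ≤ p * n
  n≤pn = m≤n*m n p
  2≤n : 2 ≤ n
  2≤n = ≤-trans (s≤s (s≤s z≤n)) 4≤n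

-- The threshold `2 * (7 + k)` lets `t * t` swallow the factor `2 + k`; it also exceeds the `k + 12`
-- of `tower-size`.
linear-bound : ∀ k t → 2 * (7 + k) ≤ t → (4 + t) * (2 + k) ≤ 2 ^ t
linear-bound k t t-large = begin
  (4 + t) * (2 + k) ≤⟨ *-mono-≤ (+-monoˡ-≤ t 4≤t) (m≤n+m (2 + k) 5) ⟩
  (t + t) * (7 + k) ≡⟨ eq t k ⟩
  t * (2 * (7 + k)) ≤⟨ *-monoʳ-≤ t t-large ⟩
  t * t             ≤⟨ subst (λ t → t * t ≤ 2 ^ t) (m+[n∸m]≡n 4≤t) (n*n≤2^n (t ∸ 4)) ⟩
  2 ^ t             ∎
  where
  open ≤-Reasoning
  4≤t : 4 ≤ t
  4≤t = ≤-trans (m≤m+n 4 (3 + (k + (7 + k + 0)))) t-large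
  eq : ∀ t k → (t + t) * (7 + k) ≡ t * (2 * (7 + k))
  eq = solve-∀

-- The tower is peeled from below: `n ^ e` has binary logarithm at most `n * e`, this one at most
-- `n + (2 + n ^ k)`, and this polynomial one at most `(4 + t) * (2 + k)`, which `2 ^ t` dominates.
power-tower : ∀ k t n → 2 * (7 + k) ≤ t → 4 ≤ n → n ≤ 2 ^ (4 + t) →
              n ^ (2 + 2 ^ (n ^ k) * 2) ≤ 2 ^ (2 ^ (2 ^ (2 ^ t)))
power-tower k t n t-large 4≤n n≤ =
  n^e≤2^ n (2 + 2 ^ (n ^ k) * 2) (exponent-bound n (n ^ k)
    (power-bound k n (4 + t) 4≤n n≤ (linear-bound k t t-large)))

tower-size : ∀ k t → 2 * (7 + k) ≤ t → k ∸ 5 + (4 * 2 ^ t + 12) ≤ 2 ^ (3 + t)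
tower-size k t t-large = begin
  k ∸ 5 + (4 * 2 ^ t + 12)    ≡⟨ eq (k ∸ 5) (4 * 2 ^ t) ⟩
  4 * 2 ^ t + (k ∸ 5 + 12)    ≤⟨ +-monoʳ-≤ (4 * 2 ^ t) 2^t-large ⟩
  4 * 2 ^ t + 4 * 2 ^ t       ≡⟨ eq₃ (2 ^ t) ⟩
  2 ^ (3 + t)                 ∎
  where
  open ≤-Reasoning
  eq : ∀ i x → i + (x + 12) ≡ x + (i + 12)
  eq = solve-∀
  eq₂ : ∀ k → k + 12 + (2 + k) ≡ 2 * (7 + k)
  eq₂ = solve-∀
  eq₃ : ∀ x → 4 * x + 4 * x ≡ 2 * (2 * (2 * x))
  eq₃ = solve-∀
  2^t-large : k ∸ 5 + 12 ≤ 4 * 2 ^ t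
  2^t-large = begin
    k ∸ 5 + 12                ≤⟨ +-monoˡ-≤ 12 (m∸n≤m k 5) ⟩
    k + 12                    ≤⟨ m≤m+n (k + 12) (2 + k) ⟩
    k + 12 + (2 + k)          ≡⟨ eq₂ k ⟩
    2 * (7 + k)               ≤⟨ t-large ⟩
    t                         ≤⟨ <⇒≤ (n<2^n t) ⟩
    2 ^ t                     ≤⟨ m≤n*m (2 ^ t) 4 ⟩
    4 * 2 ^ t                 ∎

-- Setting `m = 2 ^ t` in `lowerBound-tower` makes the size linear in `2 ^ t`, so for `n` of that
-- order the bound is triply exponential.
tower≤R : ∀ k t n → 5 ≤ k → k ∸ 5 + (4 * 2 ^ t + 12) ≤ n → 2 ^ (2 ^ (2 ^ (2 ^ t))) ≤ R (K k n)
tower≤R k t n 5≤k size = lowerBound⇒≤R {k} {n} (weaken-size size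
  (subst (λ k′ → LowerBound k′ (k ∸ 5 + (4 * 2 ^ t + 12)) (2 ^ (2 ^ (2 ^ (2 ^ t)))))
    (m∸n+n≡m 5≤k) (lowerBound-tower (k ∸ 5) (2 ^ t))))

power≤R : ∀ k t n → 5 ≤ k → 2 * (7 + k) ≤ t → 2 ^ (3 + t) ≤ n → n ≤ 2 ^ (4 + t) →
          n ^ (2 + 2 ^ (n ^ k) * 2) ≤ R (K k n)
power≤R k t n 5≤k t-large lo hi = ≤-trans
  (power-tower k t n t-large (≤-trans (^-monoʳ-≤ 2 {2} {3 + t} (s≤s (s≤s z≤n))) lo) hi)
  (tower≤R k t n 5≤k (≤-trans (tower-size k t t-large) lo))

-- Abstract so that with does not unfold the threshold, a large power of 2.
abstract
  power≤R-eventually : ∀ k → 5 ≤ k → ∃ λ n₁ → ∀ n → n₁ ≤ n → n ^ (2 + 2 ^ (n ^ k) * 2) ≤ R (K k n)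
  power≤R-eventually k 5≤k = 2 ^ (3 + 2 * (7 + k)) , λ n n₁≤n →
    large n (between-powers (3 + 2 * (7 + k)) n n₁≤n)
    where
    large : ∀ n → (∃ λ t → 3 + 2 * (7 + k) ≤ t × 2 ^ t ≤ n × n < 2 ^ suc t) →
            n ^ (2 + 2 ^ (n ^ k) * 2) ≤ R (K k n)
    large n (suc (suc (suc t)) , s≤s (s≤s (s≤s t-large)) , lo , hi) =
      power≤R k t n 5≤k t-large lo (<⇒≤ hi)

-- The function f

-- The factor `n` stands in for the constants, since it eventually exceeds both `1 / c` and `C`.
Gap : (k n g : ℕ) → Set₁
Gap k n g = ∀ (H : KGraph k n) → R H * n ≤ g ⊎ n * g ≤ R H

eventual-gaps : ∀ k → 5 ≤ k → ∃ λ n₁ → ∀ n → ∃ λ g → n ≤ g × g ≤ R (K k n) × (n₁ ≤ n → Gap k n g)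
-- The successor ensures that `n` is non-zero beyond the threshold, as `gap` demands.
eventual-gaps k 5≤k = suc n₁ , choose
  where
  n₁ : ℕ
  n₁ = proj₁ (power≤R-eventually k 5≤k)
  choose : ∀ n → ∃ λ g → n ≤ g × g ≤ R (K k n) × (suc n₁ ≤ n → Gap k n g)
  choose n with suc n₁ ≤? n
  -- Below the threshold `n` itself is a default, the gap condition being vacuous.
  ... | no n₁≰n = n , ≤-refl , n≤R (K k n) , λ n₁≤n → contradiction n₁≤n n₁≰n
  choose n@(suc _) | yes n₁<n with ramseyValues k n
  ... | v , v-all with gap (2 ^ (n ^ k)) n v
  ... | j , j≤ , missed =
      n ^ (2 + j * 2)
    , ≤-trans (≤-reflexive (sym (*-identityʳ n))) (*-monoʳ-≤ n (m^n>0 n (1 + j * 2)))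
    , ≤-trans (^-monoʳ-≤ n (+-monoʳ-≤ 2 (*-monoˡ-≤ 2 j≤)))
        (proj₂ (power≤R-eventually k 5≤k) n (<⇒≤ n₁<n))
    , λ _ H → let i , eq = v-all H in
        subst (λ r → r * n ≤ n ^ (2 + j * 2) ⊎ n * n ^ (2 + j * 2) ≤ r) (sym eq) (missed i)

module Regularised (g r : ℕ → ℕ) (n≤g : ∀ n → n ≤ g n) (g≤r : ∀ n → g n ≤ r n)
                   (r-mono : ∀ n → r n ≤ r (suc n)) where

  f : ℕ → ℕ
  f zero = g zero
  f (suc n) with f n ≤? suc n
  ... | yes _ = g (suc n)
  ... | no  _ = f n

  -- A reset occurs only when `f n` is at most `suc n`, which in turn is at most `g (suc n)`.
  f-step : ∀ n → f n ≤ f (suc n)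
  f-step n with f n ≤? suc n
  ... | yes p = ≤-trans p (n≤g (suc n))
  ... | no  _ = ≤-refl

  f-mono : m ≤ n → f m ≤ f n
  f-mono m≤n = go (≤⇒≤′ m≤n)
    where
    go : ∀ {n} → m ≤′ n → f m ≤ f n
    go ≤′-refl               = ≤-refl
    go (≤′-step {n = n} m≤n) = ≤-trans (go m≤n) (f-step n)

  n≤f : ∀ n → n ≤ f n
  n≤f zero = z≤n
  n≤f (suc n) with f n ≤? suc n
  ... | yes _ = n≤g (suc n)
  ... | no ¬p = <⇒≤ (≰⇒> ¬p)

  f≤r : ∀ n → f n ≤ r n
  f≤r zero = g≤r zero
  f≤r (suc n) with f n ≤? suc n
  ... | yes _ = g≤r (suc n)
  ... | no  _ = ≤-trans (f≤r n) (r-mono n)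

  -- As long as `f` stays constant, its lead over the identity, bounded by `d`, shrinks with every
  -- step.
  f≡g-infinitely-often : ∀ n₀ → ∃ λ n → n₀ < n × f n ≡ g n
  f≡g-infinitely-often n₀ = catch-up (f n₀) n₀ (m≤n+m (f n₀) n₀)
    where
    reset : ∀ n → f n ≤ suc n → f (suc n) ≡ g (suc n)
    reset n p with f n ≤? suc n
    ... | yes _ = refl
    ... | no ¬p = contradiction p ¬p
    stay : ∀ n → ¬ f n ≤ suc n → f (suc n) ≡ f n
    stay n ¬p with f n ≤? suc n
    ... | yes p = contradiction p ¬p
    ... | no _  = refl
    catch-up : ∀ d n → f n ≤ n + d → ∃ λ n′ → n < n′ × f n′ ≡ g n′
    catch-up zero    n p = suc n , ≤-refl ,
      reset n (≤-trans p (≤-trans (≤-reflexive (+-identityʳ n)) (n≤1+n n)))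
    catch-up (suc d) n p with f n ≤? suc n
    ... | yes q = suc n , ≤-refl , reset n q
    ... | no ¬q with catch-up d (suc n) (≤-trans (≤-reflexive (stay n ¬q))
                       (≤-trans p (≤-reflexive (+-suc n d))))
    ... | n′ , n<n′ , eq = n′ , <-trans (n<1+n n) n<n′ , eq

-- Rational and real bounds

-- Working with unnormalised rationals bypasses the reduction to lowest terms.
toℚᵘ-ℕ→ℚ : ∀ n → ℚ.toℚᵘ (ℕ→ℚ n) ℚᵘ.≃ mkℚᵘ (ℤ.+ n) 0
toℚᵘ-ℕ→ℚ n = ℚ.toℚᵘ-fromℚᵘ (mkℚᵘ (ℤ.+ n) 0)

ℕ→ℚ-mono : m ≤ n → ℕ→ℚ m ℚ.≤ ℕ→ℚ n
ℕ→ℚ-mono {m} {n} m≤n = ℚ.toℚᵘ-cancel-≤ (begin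
  ℚ.toℚᵘ (ℕ→ℚ m) ≃⟨ toℚᵘ-ℕ→ℚ m ⟩
  mkℚᵘ (ℤ.+ m) 0   ≤⟨ *≤* (ℤ.*-monoʳ-≤-nonNeg (ℤ.+ 1) (ℤ.+≤+ m≤n)) ⟩
  mkℚᵘ (ℤ.+ n) 0   ≃⟨ toℚᵘ-ℕ→ℚ n ⟨
  ℚ.toℚᵘ (ℕ→ℚ n) ∎)
  where open ℚᵘ.≤-Reasoning

ℕ→ℚ-* : ∀ m n → ℕ→ℚ (m * n) ≡ ℕ→ℚ m ℚ.* ℕ→ℚ n
ℕ→ℚ-* m n = ℚ.toℚᵘ-injective (begin-equality
  ℚ.toℚᵘ (ℕ→ℚ (m * n))                 ≃⟨ toℚᵘ-ℕ→ℚ (m * n) ⟩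
  mkℚᵘ (ℤ.+ (m * n)) 0                   ≡⟨ cong (λ z → mkℚᵘ z 0) (ℤ.pos-* m n) ⟩
  mkℚᵘ (ℤ.+ m) 0 ℚᵘ.* mkℚᵘ (ℤ.+ n) 0       ≃⟨ ℚᵘ.*-cong (toℚᵘ-ℕ→ℚ m) (toℚᵘ-ℕ→ℚ n) ⟨
  ℚ.toℚᵘ (ℕ→ℚ m) ℚᵘ.* ℚ.toℚᵘ (ℕ→ℚ n)   ≃⟨ ℚ.toℚᵘ-homo-* (ℕ→ℚ m) (ℕ→ℚ n) ⟨
  ℚ.toℚᵘ (ℕ→ℚ m ℚ.* ℕ→ℚ n)             ∎)
  where open ℚᵘ.≤-Reasoning

ℕ→ℚ-nonNeg : ∀ n → ℚ.NonNegative (ℕ→ℚ n)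
ℕ→ℚ-nonNeg n = ℚ.normalize-nonNeg n 1

archimedean : ∀ q → ∃ λ n → q ℚ.≤ ℕ→ℚ n
archimedean q@(ℚ.mkℚ p d _) = ℤ.∣ p ∣ , ℚ.toℚᵘ-cancel-≤ (begin
  ℚ.toℚᵘ q                ≤⟨ *≤* bound ⟩
  mkℚᵘ (ℤ.+ ℤ.∣ p ∣) 0      ≃⟨ toℚᵘ-ℕ→ℚ ℤ.∣ p ∣ ⟨
  ℚ.toℚᵘ (ℕ→ℚ ℤ.∣ p ∣)    ∎)
  where
  open ℚᵘ.≤-Reasoning
  bound : p ℤ.* ℤ.+ 1 ℤ.≤ ℤ.+ ℤ.∣ p ∣ ℤ.* ℤ.+ suc d
  bound = ℤ.≤-trans (ℤ.≤-reflexive (ℤ.*-identityʳ p)) (lemma p)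
    where
    lemma : ∀ p → p ℤ.≤ ℤ.+ ℤ.∣ p ∣ ℤ.* ℤ.+ suc d
    lemma (ℤ.+ n)      = ℤ.≤-trans (ℤ.+≤+ (m≤m*n n (suc d))) (ℤ.≤-reflexive (ℤ.pos-* n (suc d)))
    lemma ℤ.-[1+ n ] = ℤ.-≤+

p≤p+ε : ∀ {p q ε} → 0ℚ ℚ.< ε → p ℚ.≤ q → p ℚ.≤ q ℚ.+ ε
p≤p+ε {p} {q} {ε} 0<ε p≤q =
  subst (ℚ._≤ q ℚ.+ ε) (ℚ.+-identityʳ p) (ℚ.+-mono-≤ p≤q (ℚ.<⇒≤ 0<ε))

-- Eventually `c` is at least some `δ > 0`; once `n` is at least `1 / δ`, `a` is at most
-- `δ * n * a`, hence at most `δ * g`.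
below-multiple : ∀ c → 0ᴿ <ᴿ c → ∃ λ n₁ → ∀ a n g → n₁ ≤ n → a * n ≤ g → ℕ→ℝ a ≤ᴿ c · g
below-multiple c (δ , 0<δ , M , δ≤) = proj₁ (archimedean 1/δ) , bound
  where
  instance
    δ>0 : ℚ.Positive δ
    δ>0 = ℚ.positive 0<δ
    δ≥0 : ℚ.NonNegative δ
    δ≥0 = ℚ.pos⇒nonNeg δ
    δ≢0 : ℚ.NonZero δ
    δ≢0 = ℚ.pos⇒nonZero δ
  1/δ = ℚ.1/ δ
  bound : ∀ a n g → proj₁ (archimedean 1/δ) ≤ n → a * n ≤ g → ℕ→ℝ a ≤ᴿ c · g
  bound a n g n₁≤n an≤g ε 0<ε = M , λ i M≤i → p≤p+ε 0<ε (begin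
    ℕ→ℚ a                             ≡⟨ ℚ.*-identityˡ (ℕ→ℚ a) ⟨
    1ℚ ℚ.* ℕ→ℚ a                      ≡⟨ cong (ℚ._* ℕ→ℚ a) (ℚ.*-inverseʳ δ) ⟨
    δ ℚ.* 1/δ ℚ.* ℕ→ℚ a               ≤⟨ ℚ.*-monoʳ-≤-nonNeg (ℕ→ℚ a) {{ℕ→ℚ-nonNeg a}}
                                           (ℚ.*-monoˡ-≤-nonNeg δ (ℚ.≤-trans
                                             (proj₂ (archimedean 1/δ)) (ℕ→ℚ-mono n₁≤n))) ⟩
    δ ℚ.* ℕ→ℚ n ℚ.* ℕ→ℚ a             ≡⟨ ℚ.*-assoc δ (ℕ→ℚ n) (ℕ→ℚ a) ⟩
    δ ℚ.* (ℕ→ℚ n ℚ.* ℕ→ℚ a)           ≡⟨ cong (δ ℚ.*_) (ℕ→ℚ-* n a) ⟨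
    δ ℚ.* ℕ→ℚ (n * a)                 ≤⟨ ℚ.*-monoˡ-≤-nonNeg δ
                                           (ℕ→ℚ-mono (≤-trans (≤-reflexive (*-comm n a)) an≤g)) ⟩
    δ ℚ.* ℕ→ℚ g                       ≤⟨ ℚ.*-monoʳ-≤-nonNeg (ℕ→ℚ g) {{ℕ→ℚ-nonNeg g}}
                                           (subst (ℚ._≤ seq c i) (ℚ.+-identityˡ δ) (δ≤ i M≤i)) ⟩
    seq c i ℚ.* ℕ→ℚ g                 ∎)
    where open ℚ.≤-Reasoning

p≤∣p∣ : ∀ p → p ℚ.≤ ℚ.∣ p ∣
p≤∣p∣ p with ℚ.≤-total 0ℚ p
... | inj₁ 0≤p = ℚ.≤-reflexive (sym (ℚ.0≤p⇒∣p∣≡p 0≤p))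
... | inj₂ p≤0 = ℚ.≤-trans p≤0 (ℚ.0≤∣p∣ p)

-- A Cauchy sequence is eventually bounded by a rational `B`, and `n` need only exceed that.
above-multiple : ∀ C → ∃ λ n₁ → ∀ a n g → n₁ ≤ n → n * g ≤ a → C · g ≤ᴿ ℕ→ℝ a
above-multiple C = proj₁ (archimedean B) , bound
  where
  0<1 = ℚ.positive⁻¹ 1ℚ
  i₀ = proj₁ (cauchy C 1ℚ 0<1)
  B = seq C i₀ ℚ.+ 1ℚ
  open ℚ.≤-Reasoning
  bounded : ∀ i → i₀ ≤ i → seq C i ℚ.≤ B
  bounded i i₀≤i = begin
    seq C i                             ≡⟨ ℚ.+-identityʳ (seq C i) ⟨
    seq C i ℚ.+ 0ℚ                      ≡⟨ cong (seq C i ℚ.+_) (ℚ.+-inverseˡ (seq C i₀)) ⟨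
    seq C i ℚ.+ (ℚ.- seq C i₀ ℚ.+ seq C i₀) ≡⟨ ℚ.+-assoc (seq C i) (ℚ.- seq C i₀) (seq C i₀) ⟨
    seq C i ℚ.- seq C i₀ ℚ.+ seq C i₀     ≡⟨ ℚ.+-comm (seq C i ℚ.- seq C i₀) (seq C i₀) ⟩
    seq C i₀ ℚ.+ (seq C i ℚ.- seq C i₀)   ≤⟨ ℚ.+-monoʳ-≤ (seq C i₀) (ℚ.≤-trans (p≤∣p∣ _)
                                             (proj₂ (cauchy C 1ℚ 0<1) i i₀ i₀≤i ≤-refl)) ⟩
    B                                   ∎
  bound : ∀ a n g → proj₁ (archimedean B) ≤ n → n * g ≤ a → C · g ≤ᴿ ℕ→ℝ a
  bound a n g n₁≤n ng≤a ε 0<ε = i₀ , λ i i₀≤i → p≤p+ε 0<ε (begin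
    seq C i ℚ.* ℕ→ℚ g       ≤⟨ ℚ.*-monoʳ-≤-nonNeg (ℕ→ℚ g) {{ℕ→ℚ-nonNeg g}}
                                 (ℚ.≤-trans (bounded i i₀≤i)
                                   (ℚ.≤-trans (proj₂ (archimedean B)) (ℕ→ℚ-mono n₁≤n))) ⟩
    ℕ→ℚ n ℚ.* ℕ→ℚ g         ≡⟨ ℕ→ℚ-* n g ⟨
    ℕ→ℚ (n * g)             ≤⟨ ℕ→ℚ-mono ng≤a ⟩
    ℕ→ℚ a                   ∎)

theorem1p2 : ∀ (k : ℕ) → 5 ≤ k →
    ∃ λ (f : ℕ → ℕ) →
    (∀ {m n} → m ≤ n → f m ≤ f n)
    × (∀ n → n ≤ f n × f n ≤ R (K k n))
    × (∀ (c C : ℝ) → 0ᴿ <ᴿ c → 0ᴿ <ᴿ C → ∀ (n₀ : ℕ) →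
    ∃ λ n → n₀ < n ×
    (∀ (H : KGraph k n) →
    ℕ→ℝ (R H) ≤ᴿ c · f n ⊎ C · f n ≤ᴿ ℕ→ℝ (R H)))
theorem1p2 k 5≤k = f , f-mono , (λ n → n≤f n , f≤r n) , dichotomy
  where
  n₁ = proj₁ (eventual-gaps k 5≤k)
  gaps = proj₂ (eventual-gaps k 5≤k)
  open Regularised (λ n → proj₁ (gaps n)) (λ n → R (K k n))
    (λ n → proj₁ (proj₂ (gaps n))) (λ n → proj₁ (proj₂ (proj₂ (gaps n)))) (R-K-mono k)
  dichotomy : ∀ (c C : ℝ) → 0ᴿ <ᴿ c → 0ᴿ <ᴿ C → ∀ (n₀ : ℕ) →
    ∃ λ n → n₀ < n ×
    (∀ (H : KGraph k n) → ℕ→ℝ (R H) ≤ᴿ c · f n ⊎ C · f n ≤ᴿ ℕ→ℝ (R H))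
  dichotomy c C 0<c _ n₀ =
    let n₂ , below       = below-multiple c 0<c
        n₃ , above       = above-multiple C
        -- A place where `f` equals `g`, beyond `n₀` and the thresholds for the gap, for `c` and for
        -- `C`.
        n , large , f≡g  = f≡g-infinitely-often (n₀ ⊔ (n₁ ⊔ (n₂ ⊔ n₃)))
        n₁₂₃≤n           = ≤-trans (m≤n⊔m n₀ _) (<⇒≤ large)
        n₂₃≤n            = ≤-trans (m≤n⊔m n₁ (n₂ ⊔ n₃)) n₁₂₃≤n
        gap-at-f         = subst (Gap k n) (sym f≡g)
                             (proj₂ (proj₂ (proj₂ (gaps n))) (≤-trans (m≤m⊔n n₁ (n₂ ⊔ n₃)) n₁₂₃≤n))
    in n , ≤-<-trans (m≤m⊔n n₀ _) large , λ H → Sum.map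
         (below (R H) n (f n) (≤-trans (m≤m⊔n n₂ n₃) n₂₃≤n))
         (above (R H) n (f n) (≤-trans (m≤n⊔m n₂ n₃) n₂₃≤n))
         (gap-at-f H)
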